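{- Let $\mathcal{T}=(\psi_{\mathsf{init}},\tau,\psi_{\mathsf{err}})$ be a safety problem over a theory $\mathcal{A}$ (as described in the context). Let $\mathsf{cvp}$ be any conjunctive variable projection and $\mathsf{tp}$ any transitive projection. If the algorithm TRL (described in the context), run on $\mathcal{T}$, returns $\mathsf{safe}$, then $\mathcal{T}$ is safe.
   Context: Setting. $\mathcal{A}$ is a complete first-order theory with signature $\Sigma$ and carrier $\mathcal{C}$ that has an effective quantifier elimination procedure. $\mathsf{QF}(\Sigma)$ is the set of quantifier-free $\Sigma$-formulas, $\mathsf{QF}_\land(\Sigma)$ the set of conjunctions of $\Sigma$-literals. A valuation is a partial map $\sigma$ from variables to $\mathcal{C}$; $\sigma\models\psi$ means all variables of $\psi$ are in $\mathrm{dom}(\sigma)$ and $\sigma(\psi)$ is valid in $\mathcal{A}$; $\psi$ is consistent with $\sigma$ if $\sigma(\psi)$ is satisfiable. Fix $d\in\mathbb{N}$ and disjoint vectors $\vec x=(x_1,\dots,x_d)$ (pre-variables) and $\vec x'=(x'_1,\dots,x'_d)$ (post-variables) of pairwise distinct variables; all other variables are extra variables. Each $\tau\in\mathsf{QF}(\Sigma)$ (a relational formula) induces a relation $\to_\tau$ on $\mathcal{C}^d$: $\vec v\to_\tau\vec v'$ iff $\tau[\vec x/\vec v,\vec x'/\vec v']$ is satisfiable. A transition is a conjunction of literals whose variables are among $\vec x\cup\vec x'$. A safety problem is a triple $(\psi_{\mathsf{init}},\tau,\psi_{\mathsf{err}})$ of formulas in $\mathsf{QF}(\Sigma)$ with the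 variables of $\psi_{\mathsf{init}},\psi_{\mathsf{err}}$ among $\vec x$; it is unsafe if there are $\vec v,\vec v'$ with $[\vec x/\vec v]\models\psi_{\mathsf{init}}$, $\vec v\to_\tau^*\vec v'$, $[\vec x/\vec v']\models\psi_{\mathsf{err}}$, and safe otherwise. Conjunctive variable projection: a function $\mathsf{cvp}$ mapping $(\tau,\sigma,X)$ (formula, valuation, variable set) to a formula such that for all $\tau$, $X$ and $\sigma\models\tau$: (1) $\sigma\models\mathsf{cvp}(\tau,\sigma,X)$; (2) $\mathsf{cvp}(\tau,\sigma,X)\models\tau$; (3) $\{\mathsf{cvp}(\tau,\theta,X)\mid\theta\models\tau\}$ is finite; (4) the variables of $\mathsf{cvp}(\tau,\sigma,X)$ lie in $X\cap\mathcal V(\tau)$; (5) $\mathsf{cvp}(\tau,\sigma,X)\in\mathsf{QF}_\land(\Sigma)$. Write $\mathsf{cvp}(\tau,\sigma):=\mathsf{cvp}(\tau,\sigma,\vec x\cup\vec x')$. Transitive projection: a function $\mathsf{tp}$ mapping (formula, valuation) to a formula such that for every transition $\tau$ and every $\sigma\models\tau$: (1) $\mathsf{tp}(\tau,\sigma)$ is consistent with $\sigma$; (2) $\{\mathsf{tp}(\tau,\theta)\mid\theta\models\tau\}$ is finite; (3) $\to_{\mathsf{tp}(\tau,\sigma)}$ is transitive. Renamings. Let $\vec x^{(1)},\vec x^{(2)},\dots$ be disjoint vectors of fresh variables, and let $x_{\mathsf{id}}$ be a fresh variable with fresh copies $x^{(i)}_{\mathsf{id}}$. For $i,j\ge1$,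 $\mu_{i,j}$ maps each post-variable $x'_k$ to $x^{(i+j)}_k$ and every other variable $y$ to $y^{(i)}$; $\mu_i:=\mu_{i,1}$. For a sequence $\vec\pi$ and a model $\sigma$ of $\bigwedge_{i=1}^b\mu_i(\bigvee_{n=1}^{|\vec\pi|}(\pi_n\land x_{\mathsf{id}}\doteq n))$, the trace is $\mathsf{trace}_b(\sigma,\vec\pi)=[\mathsf{cvp}(\pi_{\sigma(x^{(i)}_{\mathsf{id}})},\sigma\circ\mu_i)]_{i=1}^b$. A sequence of transitions $\tau_1,\dots,\tau_k$ is a loop if there are $\vec v_0,\dots,\vec v_{k+1}$ with $\vec v_0\to_{\tau_1}\cdots\to_{\tau_k}\vec v_k\to_{\tau_1}\vec v_{k+1}$. For a relational formula $\pi$ and $\bar\sigma\models\pi$, $\mathsf{blocking\_clause}(s,\ell,\pi,\bar\sigma)$ is $\mu_{s,\ell}(\neg\mathsf{cvp}(\pi,\bar\sigma))\lor x^{(s)}_{\mathsf{id}}>1$ if $\ell=1$, and $\mu_{s,\ell}(\neg\mathsf{cvp}(\pi,\bar\sigma))$ if $\ell>1$. For a sequence $\vec\pi=[\pi_1,\dots]$, $\mathsf{tail}(\vec\pi)=[\pi_2,\dots]$. Algorithm TRL (uses an incremental SMT solver with operations add, push (set backtracking point), pop (remove everything added since the last push), check_sat, model). Initialize $b:=0$, $\vec\pi:=[\tau]$, $\textsc{blocked}:=\emptyset$; add $\mu_1(\psi_{\mathsf{init}})$. Repeat forever: (i) $b:=b+1$; push; add $\mu_b(\psi_{\mathsf{err}})$;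 if check_sat succeeds return $\mathsf{unknown}$, else pop. (ii) push; if $b>1$ add $x^{(b)}_{\mathsf{id}}\doteq1\lor x^{(b)}_{\mathsf{id}}\ne x^{(b-1)}_{\mathsf{id}}$; add $\mu_b(\bigvee_{n=1}^{|\vec\pi|}(\pi_n\land x_{\mathsf{id}}\doteq n))$; add every $\pi$ with $(b,\pi)\in\textsc{blocked}$. (iii) If check_sat fails, return $\mathsf{safe}$. (iv) Let $\sigma$ be the model and $[\tau_1,\dots,\tau_b]:=\mathsf{trace}_b(\sigma,\vec\pi)$. (v) If for some $s,\ell$ the subsequence $[\tau_s,\dots,\tau_{s+\ell-1}]$ is a loop (not consisting of a single transition obtained by applying $\mathsf{cvp}$ to an element of $\mathsf{tail}(\vec\pi)$): let $\sigma_{\mathsf{loop}}:=[y/\sigma(\mu_{s,\ell}(y))\mid y\in\vec x\cup\vec x']$; if no element of $\mathsf{tail}(\vec\pi)$ is consistent with $\sigma_{\mathsf{loop}}$, let $\tau_{\mathsf{loop}}:=\mu_{s,\ell}^{ -1}(\bigwedge_{i=s}^{s+\ell-1}\mu_i(\tau_i))$ and append $\mathsf{tp}(\tau_{\mathsf{loop}},\sigma\circ\mu_{s,\ell})$ to $\vec\pi$; then pick some $\pi\in\mathsf{tail}(\vec\pi)$ and a valuation $\bar\sigma\supseteq\sigma_{\mathsf{loop}}$ with $\bar\sigma\models\pi$, add $(s+\ell-1,\mathsf{blocking\_clause}(s,\ell,\pi,\bar\sigma))$ to $\textsc{blocked}$, and while $b\ge s$ do pop and $b:=b-1$.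
   Formalization: The three conditions on tp are required for all conjunctions of literals, extra variables allowed, since τ_loop has intermediate copies when ℓ>1 (else the claim is false); and the valuation given to tp is σ∘μ_{s,ℓ} except that those intermediate copies keep their value under σ. -}

module Defs where

open import Data.Bool.Base using (Bool; true; false; if_then_else_; _∧_)
open import Data.Empty using (⊥)
open import Data.Fin.Base using (Fin)
open import Data.List.Base as List using (List; []; _∷_; _++_; _∷ʳ_; [_]; foldr; concatMap; mapMaybe; applyUpTo; take; drop; filter)
open import Data.List.Membership.Propositional using (_∈_)
open import Data.List.Relation.Unary.All using (All)
open import Data.List.Relation.Unary.Any using (Any)
open import Data.Maybe.Base using (Maybe; just; nothing; _>>=_)
open import Data.Nat.Base using (ℕ; zero; suc; _+_; _∸_; _≤_; _<_; _>_; _≤ᵇ_; _<ᵇ_; _≡ᵇ_)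
open import Data.Nat.Properties using (_≟_)
open import Data.Product.Base using (∃-syntax; _×_; _,_; proj₁; proj₂)
open import Data.Sum.Base using (_⊎_; inj₁; inj₂; [_,_]′)
open import Data.Unit.Base using (⊤)
open import Data.Vec.Base as Vec using (Vec; []; _∷_; lookup)
import Data.Vec.Functional as Env
open import Function.Base using (_∘_)
open import Function.Bundles using (_⇔_)
open import Level using (0ℓ)
open import Relation.Binary.Construct.Closure.ReflexiveTransitive using (Star)
open import Relation.Binary.Definitions using (Transitive)
open import Relation.Binary.PropositionalEquality using (_≡_)
open import Relation.Nullary using (¬_)
open import Relation.Unary using (Pred)

------------------------------------------------------------------------
-- Quantifier-free formulas

infixr 6 _∧ᶠ_
infixr 5 _∨ᶠ_

data Form (A : Set) : Set where
  ⊤ᶠ        : Form A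
  atom      : A → Form A
  ¬ᶠ_       : Form A → Form A
  _∧ᶠ_ _∨ᶠ_ : Form A → Form A → Form A

module _ {A : Set} where

  Holds : (A → Set) → Form A → Set
  Holds I ⊤ᶠ       = ⊤
  Holds I (atom a) = I a
  Holds I (¬ᶠ φ)   = ¬ Holds I φ
  Holds I (φ ∧ᶠ ψ) = Holds I φ × Holds I ψ
  Holds I (φ ∨ᶠ ψ) = Holds I φ ⊎ Holds I ψ

  atoms : Form A → List A
  atoms ⊤ᶠ       = []
  atoms (atom a) = [ a ]
  atoms (¬ᶠ φ)   = atoms φ
  atoms (φ ∧ᶠ ψ) = atoms φ ++ atoms ψ
  atoms (φ ∨ᶠ ψ) = atoms φ ++ atoms ψ

  mapᶠ : {B : Set} → (A → B) → Form A → Form B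
  mapᶠ f ⊤ᶠ       = ⊤ᶠ
  mapᶠ f (atom a) = atom (f a)
  mapᶠ f (¬ᶠ φ)   = ¬ᶠ mapᶠ f φ
  mapᶠ f (φ ∧ᶠ ψ) = mapᶠ f φ ∧ᶠ mapᶠ f ψ
  mapᶠ f (φ ∨ᶠ ψ) = mapᶠ f φ ∨ᶠ mapᶠ f ψ

  -- ⊤ᶠ is the empty conjunction.
  data Conjunctive : Form A → Set where
    top : Conjunctive ⊤ᶠ
    pos : ∀ a → Conjunctive (atom a)
    neg : ∀ a → Conjunctive (¬ᶠ atom a)
    and : ∀ {φ ψ} → Conjunctive φ → Conjunctive ψ → Conjunctive (φ ∧ᶠ ψ)

record Signature : Set₁ where
  field
    Fun Rel  : Set
    funArity : Fun → ℕ
    relArity : Rel → ℕ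

module Syntax (Sg : Signature) where
  open Signature Sg

  data Term (V : Set) : Set where
    var : V → Term V
    app : (f : Fun) → Vec (Term V) (funArity f) → Term V

  data Atom (V : Set) : Set where
    rel : (r : Rel) → Vec (Term V) (relArity r) → Atom V
    _≐_ : Term V → Term V → Atom V

  QF : Set → Set
  QF V = Form (Atom V)

  module _ {V : Set} where

    mutual
      termVars : Term V → List V
      termVars (var y)    = [ y ]
      termVars (app f ts) = termsVars ts

      termsVars : ∀ {n} → Vec (Term V) n → List V
      termsVars []       = []
      termsVars (t ∷ ts) = termVars t ++ termsVars ts

    atomVars : Atom V → List V
    atomVars (rel r ts) = termsVars ts
    atomVars (t ≐ u)    = termVars t ++ termVars u

    vars : QF V → List V
    vars φ = concatMap atomVars (atoms φ)

  module _ {V W : Set} (ρ : V → W) where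

    mutual
      renameTerm : Term V → Term W
      renameTerm (var y)    = var (ρ y)
      renameTerm (app f ts) = app f (renameTerms ts)

      renameTerms : ∀ {n} → Vec (Term V) n → Vec (Term W) n
      renameTerms []       = []
      renameTerms (t ∷ ts) = renameTerm t ∷ renameTerms ts

    renameAtom : Atom V → Atom W
    renameAtom (rel r ts) = rel r (renameTerms ts)
    renameAtom (t ≐ u)    = renameTerm t ≐ renameTerm u

    rename : QF V → QF W
    rename = mapᶠ renameAtom

  -- First-order formulas with free variables in Fin n; a quantifier binds
  -- de Bruijn index zero.
  data FO (n : ℕ) : Set where
    qf      : QF (Fin n) → FO n
    not     : FO n → FO n
    and or  : FO n → FO n → FO n
    all ex  : FO (suc n) → FO n

------------------------------------------------------------------------
-- Theories

record Structure (Sg : Signature) : Set₁ where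
  open Signature Sg
  field
    Carrier : Set
    point   : Carrier
    funᴵ    : (f : Fun) → Vec Carrier (funArity f) → Carrier
    relᴵ    : (r : Rel) → Vec Carrier (relArity r) → Set

module Semantics {Sg : Signature} (𝔐 : Structure Sg) where
  open Structure 𝔐
  open Syntax Sg

  module _ {V : Set} (θ : V → Carrier) where

    mutual
      ⟦_⟧ᵗ : Term V → Carrier
      ⟦ var y ⟧ᵗ    = θ y
      ⟦ app f ts ⟧ᵗ = funᴵ f ⟦ ts ⟧ᵗˢ

      ⟦_⟧ᵗˢ : ∀ {n} → Vec (Term V) n → Vec Carrier n
      ⟦ [] ⟧ᵗˢ     = []
      ⟦ t ∷ ts ⟧ᵗˢ = ⟦ t ⟧ᵗ ∷ ⟦ ts ⟧ᵗˢ

    ⟦_⟧ᵃ : Atom V → Set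
    ⟦ rel r ts ⟧ᵃ = relᴵ r ⟦ ts ⟧ᵗˢ
    ⟦ t ≐ u ⟧ᵃ    = ⟦ t ⟧ᵗ ≡ ⟦ u ⟧ᵗ

  infix 4 _⊩_ _⊩ᶠᵒ_

  _⊩_ : {V : Set} → (V → Carrier) → QF V → Set
  θ ⊩ φ = Holds ⟦ θ ⟧ᵃ φ

  _⊩ᶠᵒ_ : ∀ {n} → (Fin n → Carrier) → FO n → Set
  θ ⊩ᶠᵒ qf φ    = θ ⊩ φ
  θ ⊩ᶠᵒ not φ   = ¬ (θ ⊩ᶠᵒ φ)
  θ ⊩ᶠᵒ and φ ψ = (θ ⊩ᶠᵒ φ) × (θ ⊩ᶠᵒ ψ)
  θ ⊩ᶠᵒ or φ ψ  = (θ ⊩ᶠᵒ φ) ⊎ (θ ⊩ᶠᵒ ψ)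
  θ ⊩ᶠᵒ all φ   = ∀ c → (c Env.∷ θ) ⊩ᶠᵒ φ
  θ ⊩ᶠᵒ ex φ    = ∃[ c ] (c Env.∷ θ) ⊩ᶠᵒ φ

  Valid : ∀ {n} → FO n → Set
  Valid φ = ∀ θ → θ ⊩ᶠᵒ φ

-- A complete theory has exactly the sentences true in its carrier structure
-- as consequences, so validity in the theory is truth in that structure.
record Theory (Sg : Signature) : Set₁ where
  open Syntax Sg
  field
    structure  : Structure Sg
  open Structure structure public
  open Semantics structure public
  field
    complete   : (φ : FO 0) → Valid φ ⊎ Valid (not φ)
    qe         : ∀ {n} → FO n → QF (Fin n)
    qe-correct : ∀ {n} (φ : FO n) θ → (θ ⊩ᶠᵒ φ) ⇔ (θ ⊩ qe φ)

------------------------------------------------------------------------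
-- Partial maps

infix 4 _∈dom_ _extends_ _⊆ᵖ_

_∈dom_ : {X Y : Set} → X → (X → Maybe Y) → Set
x ∈dom p = ∃[ y ] p x ≡ just y

_extends_ : {X Y : Set} → (X → Y) → (X → Maybe Y) → Set
f extends p = ∀ x y → p x ≡ just y → f x ≡ y

_⊆ᵖ_ : {X Y : Set} → (X → Maybe Y) → (X → Maybe Y) → Set
p ⊆ᵖ q = ∀ x y → p x ≡ just y → q x ≡ just y

module Setting {Sg : Signature} (𝒜 : Theory Sg) (d : ℕ) where
  open Theory 𝒜
  open Syntax Sg

  -- Variables are closed under y ↦ y⁽ⁱ⁾.  All variables other than pre k and
  -- post k, in particular the copies, are extra variables.
  data Var : Set where
    pre post : Fin d → Var
    extra    : ℕ → Var
    _⁽_⁾     : Var → ℕ → Var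

  Formula : Set
  Formula = QF Var

  Valuation : Set
  Valuation = Var → Maybe Carrier

  infix 4 _⊨_

  _⊨_ : Valuation → Formula → Set
  σ ⊨ φ = (∀ y → y ∈ vars φ → y ∈dom σ) × (∀ θ → θ extends σ → θ ⊩ φ)

  _ConsistentWith_ : Formula → Valuation → Set
  φ ConsistentWith σ = ∃[ θ ] (θ extends σ × θ ⊩ φ)

  Tuple : Set
  Tuple = Vec Carrier d

  [x/_] : Tuple → Valuation
  [x/ v ] (pre k) = just (lookup v k)
  [x/ v ] _       = nothing

  [x/_,x′/_] : Tuple → Tuple → Valuation
  [x/ v ,x′/ v′ ] (pre k)  = just (lookup v k)
  [x/ v ,x′/ v′ ] (post k) = just (lookup v′ k)
  [x/ v ,x′/ v′ ] _        = nothing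

  infix 4 _-[_]→_

  _-[_]→_ : Tuple → Formula → Tuple → Set
  v -[ τ ]→ v′ = τ ConsistentWith [x/ v ,x′/ v′ ]

  data IsPre : Pred Var 0ℓ where
    pre : ∀ k → IsPre (pre k)

  VarSet : Set
  VarSet = Var → Bool

  x∪x′ : VarSet
  x∪x′ (pre _)  = true
  x∪x′ (post _) = true
  x∪x′ _        = false

  record SafetyProblem : Set where
    field
      init τ err : Formula
      init-vars  : ∀ y → y ∈ vars init → IsPre y
      err-vars   : ∀ y → y ∈ vars err → IsPre y

  UnsafeProblem : SafetyProblem → Set
  UnsafeProblem T = ∃[ v ] ∃[ v′ ]
    ([x/ v ] ⊨ init × Star (λ u w → u -[ τ ]→ w) v v′ × [x/ v′ ] ⊨ err)
    where open SafetyProblem T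

  SafeProblem : SafetyProblem → Set
  SafeProblem T = ¬ UnsafeProblem T

  ----------------------------------------------------------------------
  -- Projections

  FiniteImage : (Valuation → Formula) → Formula → Set
  FiniteImage f τ = ∃[ φs ] (∀ θ → θ ⊨ τ → f θ ∈ φs)

  record IsConjunctiveVariableProjection
      (cvp : Formula → Valuation → VarSet → Formula) : Set where
    field
      model       : ∀ τ X σ → σ ⊨ τ → σ ⊨ cvp τ σ X
      -- cvp τ σ X does not mention variables outside X, so those variables
      -- of τ are read existentially.  If vars τ ⊆ X, this is plain
      -- entailment.
      entails     : ∀ τ X σ → σ ⊨ τ → ∀ θ → θ ⊩ cvp τ σ X →
                    ∃[ θ′ ] ((∀ y → X y ≡ true → θ′ y ≡ θ y) × θ′ ⊩ τ)
      finite      : ∀ τ X → FiniteImage (λ θ → cvp τ θ X) τ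
      variables   : ∀ τ X σ → σ ⊨ τ → ∀ y → y ∈ vars (cvp τ σ X) →
                    X y ≡ true × y ∈ vars τ
      conjunctive : ∀ τ X σ → σ ⊨ τ → Conjunctive (cvp τ σ X)

  -- The conjunctions τ may have extra variables: the formula that the
  -- algorithm passes to tp for a loop of several transitions has the
  -- intermediate states as extra variables.
  record IsTransitiveProjection (tp : Formula → Valuation → Formula) : Set where
    field
      consistent : ∀ τ → Conjunctive τ → ∀ σ → σ ⊨ τ →
                   tp τ σ ConsistentWith σ
      finite     : ∀ τ → Conjunctive τ → FiniteImage (tp τ) τ
      transitive : ∀ τ → Conjunctive τ → ∀ σ → σ ⊨ τ →
                   Transitive (λ u w → u -[ tp τ σ ]→ w)

  ----------------------------------------------------------------------
  -- Renamings and loops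

  μ : ℕ → ℕ → Var → Var
  μ i j (post k) = pre k ⁽ i + j ⁾
  μ i j y        = y ⁽ i ⁾

  -- Inverse of μ s ℓ on its image, identity elsewhere.
  μ⁻¹ : ℕ → ℕ → Var → Var
  μ⁻¹ s ℓ (pre k ⁽ i ⁾)  = if i ≡ᵇ s + ℓ then post k else
                           if i ≡ᵇ s then pre k else pre k ⁽ i ⁾
  μ⁻¹ s ℓ (post k ⁽ i ⁾) = post k ⁽ i ⁾
  μ⁻¹ s ℓ (y ⁽ i ⁾)      = if i ≡ᵇ s then y else y ⁽ i ⁾
  μ⁻¹ s ℓ y              = y

  -- μ s ℓ, except that the intermediate state variables, which are left
  -- alone by μ⁻¹ s ℓ, are left alone.  Composing a valuation with it gives
  -- those variables the values they have in that valuation.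
  μ-loop : ℕ → ℕ → Var → Var
  μ-loop s ℓ (pre k ⁽ i ⁾) =
    if (s <ᵇ i) ∧ (i <ᵇ s + ℓ) then pre k ⁽ i ⁾ else μ s ℓ (pre k ⁽ i ⁾)
  μ-loop s ℓ y = μ s ℓ y

  -- chain i [τ₀, τ₁, …] is the conjunction of the μ (i + j) 1 (τⱼ).
  chain : ℕ → List Formula → Formula
  chain i []       = ⊤ᶠ
  chain i (τ ∷ τs) = rename (μ i 1) τ ∧ᶠ chain (suc i) τs

  data Path : Tuple → List Formula → Tuple → Set where
    nil  : ∀ {v} → Path v [] v
    cons : ∀ {u v w τ τs} → u -[ τ ]→ v → Path v τs w → Path u (τ ∷ τs) w

  Loop : List Formula → Set
  Loop []       = ⊥
  Loop (τ ∷ τs) = ∃[ v ] ∃[ w ] Path v (τ ∷ τs ∷ʳ τ) w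

  ----------------------------------------------------------------------
  -- The solver

  -- The copies of x_id range over ℕ, not over the carrier: xid i stands for
  -- the i-th copy.
  data IdAtom : Set where
    xid_≐_    : ℕ → ℕ → IdAtom
    xid_≐xid_ : ℕ → ℕ → IdAtom
    xid_>_    : ℕ → ℕ → IdAtom

  idVars : IdAtom → List ℕ
  idVars (xid i ≐ n)    = [ i ]
  idVars (xid i ≐xid j) = i ∷ j ∷ []
  idVars (xid i > n)    = [ i ]

  ⟦_⟧ⁱ : (ℕ → ℕ) → IdAtom → Set
  ⟦ κ ⟧ⁱ (xid i ≐ n)    = κ i ≡ n
  ⟦ κ ⟧ⁱ (xid i ≐xid j) = κ i ≡ κ j
  ⟦ κ ⟧ⁱ (xid i > n)    = κ i > n

  Assertion : Set
  Assertion = Form (Atom Var ⊎ IdAtom)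

  ⌜_⌝ : Formula → Assertion
  ⌜_⌝ = mapᶠ inj₁

  idAtom : IdAtom → Assertion
  idAtom = atom ∘ inj₂

  record Model : Set where
    field
      val : Valuation
      ids : ℕ → Maybe ℕ

  record _⊨ˢ_ (M : Model) (φ : Assertion) : Set where
    open Model M
    field
      val-dom : ∀ y → y ∈ concatMap [ atomVars , (λ _ → []) ]′ (atoms φ) →
                y ∈dom val
      ids-dom : ∀ i → i ∈ concatMap [ (λ _ → []) , idVars ]′ (atoms φ) →
                i ∈dom ids
      holds   : ∀ θ κ → θ extends val → κ extends ids →
                Holds [ ⟦ θ ⟧ᵃ , ⟦ κ ⟧ⁱ ]′ φ

  record Solver : Set where
    constructor solver
    field
      assertions : List Assertion
      saved      : List (List Assertion)

  open Solver

  emptySolver : Solver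
  emptySolver = solver [] []

  push : Solver → Solver
  push (solver φs ss) = solver φs (φs ∷ ss)

  pop : Solver → Solver
  pop (solver φs [])        = solver φs []
  pop (solver φs (ψs ∷ ss)) = solver ψs ss

  add : Assertion → Solver → Solver
  add φ (solver φs ss) = solver (φ ∷ φs) ss

  _Satisfies_ : Model → Solver → Set
  M Satisfies S = All (M ⊨ˢ_) (assertions S)

  CheckSat : Solver → Set
  CheckSat S = ∃[ M ] M Satisfies S

  ----------------------------------------------------------------------
  -- The algorithm

  -- xs ‼ n is the n-th element of xs, counted from 1.
  _‼_ : {A : Set} → List A → ℕ → Maybe A
  []       ‼ n             = nothing
  (x ∷ xs) ‼ 0             = nothing
  (x ∷ xs) ‼ 1             = just x
  (x ∷ xs) ‼ suc n@(suc _) = xs ‼ n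

  tail : {A : Set} → List A → List A
  tail = drop 1

  data Result : Set where
    unknown safe : Result

  module TRL (T : SafetyProblem)
             (cvp : Formula → Valuation → VarSet → Formula)
             (tp : Formula → Valuation → Formula) where
    open SafetyProblem T

    cvp′ : Formula → Valuation → Formula
    cvp′ φ σ = cvp φ σ x∪x′

    record State : Set where
      constructor state
      field
        b       : ℕ
        π⃗       : List Formula
        blocked : List (ℕ × Assertion)
        smt     : Solver

    data Config : Set where
      running  : State → Config
      returned : Result → Config

    initial : State
    initial = state 0 [ τ ] [] (add ⌜ rename (μ 1 1) init ⌝ emptySolver)

    -- Below, b is the bound already incremented in the current iteration.

    errorCheck : ℕ → Solver → Solver
    errorCheck b S = add ⌜ rename (μ b 1) err ⌝ (push S)

    -- disjunction b n [πₙ, πₙ₊₁, …] is μ_b of the disjunction of the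
    -- formulas πₘ ∧ x_id ≐ m with m ≥ n.
    disjunction : ℕ → ℕ → List Formula → Assertion
    disjunction b n []       = ¬ᶠ ⊤ᶠ
    disjunction b n (π ∷ πs) =
      (⌜ rename (μ b 1) π ⌝ ∧ᶠ idAtom (xid b ≐ n)) ∨ᶠ disjunction b (suc n) πs

    addIdConstraint : ℕ → Solver → Solver
    addIdConstraint b S =
      if 1 <ᵇ b
      then add (idAtom (xid b ≐ 1) ∨ᶠ ¬ᶠ idAtom (xid b ≐xid (b ∸ 1))) S
      else S

    blockedAt : ℕ → List (ℕ × Assertion) → List Assertion
    blockedAt b = List.map proj₂ ∘ filter (λ p → proj₁ p ≟ b)

    unroll : ℕ → List Formula → List (ℕ × Assertion) → Solver → Solver
    unroll b π⃗ blocked S =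
      foldr add (add (disjunction b 1 π⃗) (addIdConstraint b (push S)))
                (blockedAt b blocked)

    traceAt : Model → List Formula → ℕ → Maybe Formula
    traceAt M π⃗ i =
      ids i >>= λ n → (π⃗ ‼ n) >>= λ π → just (cvp′ π (val ∘ μ i 1))
      where open Model M

    -- traceAt is defined at 1, …, b if M is a model of the assertions.
    trace : ℕ → Model → List Formula → List Formula
    trace b M π⃗ = mapMaybe (traceAt M π⃗) (applyUpTo suc b)

    segment : ℕ → ℕ → List Formula → List Formula
    segment s ℓ τs = take ℓ (drop (s ∸ 1) τs)

    -- The s-th trace element comes from an element of tail π⃗.
    LearnedAt : Model → ℕ → Set
    LearnedAt M s = ∃[ n ] (Model.ids M s ≡ just n × n > 1)

    record LoopAt (b : ℕ) (M : Model) (τs : List Formula) (s ℓ : ℕ) : Set where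
      field
        1≤s         : 1 ≤ s
        1≤ℓ         : 1 ≤ ℓ
        inside      : s + ℓ ∸ 1 ≤ b
        loop        : Loop (segment s ℓ τs)
        not-learned : ¬ (ℓ ≡ 1 × LearnedAt M s)

    σ-loop : Model → ℕ → ℕ → Valuation
    σ-loop M s ℓ y@(pre _)  = Model.val M (μ s ℓ y)
    σ-loop M s ℓ y@(post _) = Model.val M (μ s ℓ y)
    σ-loop M s ℓ _          = nothing

    τ-loop : List Formula → ℕ → ℕ → Formula
    τ-loop τs s ℓ = rename (μ⁻¹ s ℓ) (chain s (segment s ℓ τs))

    data Learn (M : Model) (τs : List Formula) (s ℓ : ℕ) (π⃗ : List Formula) :
               List Formula → Set where
      reuse : Any (_ConsistentWith σ-loop M s ℓ) (tail π⃗) →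
              Learn M τs s ℓ π⃗ π⃗
      new   : ¬ Any (_ConsistentWith σ-loop M s ℓ) (tail π⃗) →
              Learn M τs s ℓ π⃗
                (π⃗ ∷ʳ tp (τ-loop τs s ℓ) (Model.val M ∘ μ-loop s ℓ))

    blockingClause : ℕ → ℕ → Formula → Valuation → Assertion
    blockingClause s 1 π σ̄ =
      ⌜ rename (μ s 1) (¬ᶠ cvp′ π σ̄) ⌝ ∨ᶠ idAtom (xid s > 1)
    blockingClause s ℓ π σ̄ = ⌜ rename (μ s ℓ) (¬ᶠ cvp′ π σ̄) ⌝

    -- while b ≥ s do pop and b := b - 1
    backtrack : ℕ → ℕ → Solver → ℕ × Solver
    backtrack s zero    S = zero , S
    backtrack s (suc b) S =
      if s ≤ᵇ suc b then backtrack s b (pop S) else (suc b , S)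

    infix 4 _⟿_

    data _⟿_ : Config → Config → Set where

      return-unknown : ∀ {b π⃗ blocked S} →
        CheckSat (errorCheck (suc b) S) →
        running (state b π⃗ blocked S) ⟿ returned unknown

      return-safe : ∀ {b π⃗ blocked S} →
        ¬ CheckSat (errorCheck (suc b) S) →
        ¬ CheckSat (unroll (suc b) π⃗ blocked (pop (errorCheck (suc b) S))) →
        running (state b π⃗ blocked S) ⟿ returned safe

      no-loop : ∀ {b π⃗ blocked S} (M : Model) →
        let S′ = unroll (suc b) π⃗ blocked (pop (errorCheck (suc b) S)) in
        ¬ CheckSat (errorCheck (suc b) S) →
        M Satisfies S′ →
        (∀ s ℓ → ¬ LoopAt (suc b) M (trace (suc b) M π⃗) s ℓ) →
        running (state b π⃗ blocked S) ⟿ running (state (suc b) π⃗ blocked S′)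

      block-loop : ∀ {b π⃗ blocked S} (M : Model) (s ℓ : ℕ)
        (π⃗′ : List Formula) (π : Formula) (σ̄ : Valuation) →
        let S′ = unroll (suc b) π⃗ blocked (pop (errorCheck (suc b) S))
            τs = trace (suc b) M π⃗
            b″ = proj₁ (backtrack s (suc b) S′)
            S″ = proj₂ (backtrack s (suc b) S′)
        in
        ¬ CheckSat (errorCheck (suc b) S) →
        M Satisfies S′ →
        LoopAt (suc b) M τs s ℓ →
        Learn M τs s ℓ π⃗ π⃗′ →
        π ∈ tail π⃗′ →
        σ-loop M s ℓ ⊆ᵖ σ̄ →
        σ̄ ⊨ π →
        running (state b π⃗ blocked S) ⟿
        running (state b″ π⃗′
                   ((s + ℓ ∸ 1 , blockingClause s ℓ π σ̄) ∷ blocked) S″)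

    Returns : Result → Set
    Returns r = Star _⟿_ (running initial) (returned r)

{-# OPTIONS --safe #-}
module Submission where

-- A formula that remains in the solver at level i was asserted with a list ρ i
-- that is a prefix of the current list of relations, and all blocking clauses
-- of level i speak of learned relations that occur in ρ s, where s is the first
-- level of the blocked segment.  By induction on a run of τ, every reachable
-- state is the last state of a model of the assertions of some level: extend
-- the model for the predecessor by a step with τ.  If this violates a blocking
-- clause, a learned relation leads to the new state from the start of the
-- blocked segment.  If a step with a learned relation follows a step with the
-- same relation, transitivity merges the two.  Either repair lowers the level,
-- or it replaces τ by a learned relation on the same level, so repairing
-- terminates.  As the final level is unsatisfiable, a reachable error state
-- would have been found by an error check at a lower level.
--
-- Satisfaction of formulas is not decidable here, but the claim is a negation,
-- so the case distinctions are made under a double negation.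

open import Data.Bool.Base using (true; false; T; if_then_else_)
open import Data.Bool.Properties using (T-∧)
open import Data.Empty using (⊥; ⊥-elim)
open import Data.List.Base using (List; []; _∷_; _++_; _∷ʳ_; [_]; map; foldr; concatMap; mapMaybe; applyUpTo; take; drop)
open import Data.List.Membership.Propositional using (_∈_)
open import Data.List.Membership.Propositional.Properties using (∈-++⁺ˡ; ∈-++⁺ʳ; ∈-++⁻; ∈-map⁺; ∈-map⁻; ∈-filter⁻; ∈-concatMap⁺)
open import Data.List.Properties using (map-++; ++-assoc; concatMap-++; concatMap-map; map-concatMap; concatMap-cong; filter-reject)
open import Data.List.Relation.Unary.All using (All; []; _∷_)
import Data.List.Relation.Unary.All as All
import Data.List.Relation.Unary.All.Properties as All
import Data.List.Relation.Unary.Any as Any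
open import Data.List.Relation.Unary.Any using (here; there)
open import Data.Maybe.Base using (just; fromMaybe)
open import Data.Maybe.Properties using (just-injective)
open import Data.Nat.Base using (ℕ; zero; suc; _+_; _∸_; _≤_; _<_; _>_; z≤n; s≤s; _<ᵇ_)
open import Data.Nat.Induction using (<-rec)
open import Data.Nat.Properties
open import Data.Product.Base using (∃-syntax; _×_; _,_; proj₁; proj₂)
open import Data.Sum.Base using (_⊎_; inj₁; inj₂; [_,_]′)
open import Data.Unit.Base using (tt)
open import Data.Vec.Base using (Vec; []; _∷_; lookup; tabulate)
open import Data.Vec.Properties using (lookup∘tabulate)
open import Function.Base using (_∘_; id)
open import Function.Bundles using (Equivalence)
open import Relation.Binary.Construct.Closure.ReflexiveTransitive using (Star; ε; _◅_)
open import Relation.Binary.Definitions using (Transitive; tri<; tri≈; tri>)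
open import Relation.Binary.PropositionalEquality hiding ([_])
open import Relation.Nullary using (¬_; yes; no; contradiction)

open import Defs

-- Conditionals, spliced sequences and propositional formulas.

module _ {A : Set} where

  if-T : ∀ {b} {x y : A} → T b → (if b then x else y) ≡ x
  if-T {true} _ = refl

  if-¬T : ∀ {b} {x y : A} → ¬ T b → (if b then x else y) ≡ y
  if-¬T {false} _  = refl
  if-¬T {true}  ¬t = contradiction tt ¬t

  splice : ℕ → (ℕ → A) → A → A → ℕ → A
  splice m f x y n with <-cmp n m
  ... | tri< _ _ _ = f n
  ... | tri≈ _ _ _ = x
  ... | tri> _ _ _ = y

  module _ {m : ℕ} {f : ℕ → A} {x y : A} where

    splice-< : ∀ {n} → n < m → splice m f x y n ≡ f n
    splice-< {n} n<m with <-cmp n m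
    ... | tri< _ _ _   = refl
    ... | tri≈ n≮m _ _ = contradiction n<m n≮m
    ... | tri> n≮m _ _ = contradiction n<m n≮m

    splice-≡ : splice m f x y m ≡ x
    splice-≡ with <-cmp m m
    ... | tri< _ m≢m _ = contradiction refl m≢m
    ... | tri≈ _ _ _   = refl
    ... | tri> _ m≢m _ = contradiction refl m≢m

    splice-> : ∀ {n} → m < n → splice m f x y n ≡ y
    splice-> {n} m<n with <-cmp n m
    ... | tri< _ _ m≮n = contradiction m<n m≮n
    ... | tri≈ _ _ m≮n = contradiction m<n m≮n
    ... | tri> _ _ _   = refl

  -- An equality of types rather than an implication, since negation reverses the direction. Facts
  -- are transported along it with `subst id`.
  Holds-cong : ∀ {I J : A → Set} φ → (∀ {a} → a ∈ atoms φ → I a ≡ J a) →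
               Holds I φ ≡ Holds J φ
  Holds-cong ⊤ᶠ       _  = refl
  Holds-cong (atom a) eq = eq (here refl)
  Holds-cong (¬ᶠ φ)   eq = cong ¬_ (Holds-cong φ eq)
  Holds-cong (φ ∧ᶠ ψ) eq =
    cong₂ _×_ (Holds-cong φ (eq ∘ ∈-++⁺ˡ)) (Holds-cong ψ (eq ∘ ∈-++⁺ʳ (atoms φ)))
  Holds-cong (φ ∨ᶠ ψ) eq =
    cong₂ _⊎_ (Holds-cong φ (eq ∘ ∈-++⁺ˡ)) (Holds-cong ψ (eq ∘ ∈-++⁺ʳ (atoms φ)))

  module _ {B : Set} (f : A → B) where

    Holds-mapᶠ : ∀ {I : B → Set} φ → Holds I (mapᶠ f φ) ≡ Holds (I ∘ f) φ
    Holds-mapᶠ ⊤ᶠ       = refl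
    Holds-mapᶠ (atom a) = refl
    Holds-mapᶠ (¬ᶠ φ)   = cong ¬_ (Holds-mapᶠ φ)
    Holds-mapᶠ (φ ∧ᶠ ψ) = cong₂ _×_ (Holds-mapᶠ φ) (Holds-mapᶠ ψ)
    Holds-mapᶠ (φ ∨ᶠ ψ) = cong₂ _⊎_ (Holds-mapᶠ φ) (Holds-mapᶠ ψ)

    atoms-mapᶠ : ∀ φ → atoms (mapᶠ f φ) ≡ map f (atoms φ)
    atoms-mapᶠ ⊤ᶠ       = refl
    atoms-mapᶠ (atom a) = refl
    atoms-mapᶠ (¬ᶠ φ)   = atoms-mapᶠ φ
    atoms-mapᶠ (φ ∧ᶠ ψ) = trans (cong₂ _++_ (atoms-mapᶠ φ) (atoms-mapᶠ ψ))
                                (sym (map-++ f (atoms φ) (atoms ψ)))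
    atoms-mapᶠ (φ ∨ᶠ ψ) = trans (cong₂ _++_ (atoms-mapᶠ φ) (atoms-mapᶠ ψ))
                                (sym (map-++ f (atoms φ) (atoms ψ)))

    Conjunctive-mapᶠ : ∀ {φ} → Conjunctive φ → Conjunctive (mapᶠ f φ)
    Conjunctive-mapᶠ top       = top
    Conjunctive-mapᶠ (pos a)   = pos (f a)
    Conjunctive-mapᶠ (neg a)   = neg (f a)
    Conjunctive-mapᶠ (and c e) = and (Conjunctive-mapᶠ c) (Conjunctive-mapᶠ e)

-- Renaming and coincidence for terms, atoms and formulas.

module _ {Sg : Signature} where
  open Syntax Sg

  module _ {V W : Set} (f : V → W) where

    mutual
      termVars-rename : ∀ t → termVars (renameTerm f t) ≡ map f (termVars t)
      termVars-rename (var y)    = refl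
      termVars-rename (app g ts) = termsVars-rename ts

      termsVars-rename : ∀ {n} (ts : Vec (Term V) n) →
                         termsVars (renameTerms f ts) ≡ map f (termsVars ts)
      termsVars-rename []       = refl
      termsVars-rename (t ∷ ts) =
        trans (cong₂ _++_ (termVars-rename t) (termsVars-rename ts))
              (sym (map-++ f (termVars t) (termsVars ts)))

    atomVars-rename : ∀ a → atomVars (renameAtom f a) ≡ map f (atomVars a)
    atomVars-rename (rel r ts) = termsVars-rename ts
    atomVars-rename (t ≐ u)    =
      trans (cong₂ _++_ (termVars-rename t) (termVars-rename u))
            (sym (map-++ f (termVars t) (termVars u)))

    vars-rename : ∀ φ → vars (rename f φ) ≡ map f (vars φ)
    vars-rename φ = begin
      concatMap atomVars (atoms (rename f φ))
        ≡⟨ cong (concatMap atomVars) (atoms-mapᶠ (renameAtom f) φ) ⟩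
      concatMap atomVars (map (renameAtom f) (atoms φ))
        ≡⟨ concatMap-map atomVars (renameAtom f) (atoms φ) ⟩
      concatMap (atomVars ∘ renameAtom f) (atoms φ)
        ≡⟨ concatMap-cong atomVars-rename (atoms φ) ⟩
      concatMap (map f ∘ atomVars) (atoms φ)
        ≡⟨ map-concatMap f atomVars (atoms φ) ⟨
      map f (vars φ) ∎
      where open ≡-Reasoning

    ∈-vars-rename⁺ : ∀ {y} φ → y ∈ vars φ → f y ∈ vars (rename f φ)
    ∈-vars-rename⁺ φ y∈ = subst (_ ∈_) (sym (vars-rename φ)) (∈-map⁺ f y∈)

    ∈-vars-rename⁻ : ∀ {z} φ → z ∈ vars (rename f φ) → ∃[ y ] y ∈ vars φ × z ≡ f y
    ∈-vars-rename⁻ φ z∈ = ∈-map⁻ f (subst (_ ∈_) (vars-rename φ) z∈)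

  module _ (𝔐 : Structure Sg) where
    open Structure 𝔐
    open Semantics 𝔐

    module _ {V : Set} {θ θ′ : V → Carrier} where

      mutual
        ⟦⟧ᵗ-cong : ∀ t → (∀ {y} → y ∈ termVars t → θ y ≡ θ′ y) → ⟦ θ ⟧ᵗ t ≡ ⟦ θ′ ⟧ᵗ t
        ⟦⟧ᵗ-cong (var y)    eq = eq (here refl)
        ⟦⟧ᵗ-cong (app f ts) eq = cong (funᴵ f) (⟦⟧ᵗˢ-cong ts eq)

        ⟦⟧ᵗˢ-cong : ∀ {n} (ts : Vec (Term V) n) →
                    (∀ {y} → y ∈ termsVars ts → θ y ≡ θ′ y) → ⟦ θ ⟧ᵗˢ ts ≡ ⟦ θ′ ⟧ᵗˢ ts
        ⟦⟧ᵗˢ-cong []       eq = refl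
        ⟦⟧ᵗˢ-cong (t ∷ ts) eq =
          cong₂ _∷_ (⟦⟧ᵗ-cong t (eq ∘ ∈-++⁺ˡ)) (⟦⟧ᵗˢ-cong ts (eq ∘ ∈-++⁺ʳ (termVars t)))

      ⟦⟧ᵃ-cong : ∀ a → (∀ {y} → y ∈ atomVars a → θ y ≡ θ′ y) → ⟦ θ ⟧ᵃ a ≡ ⟦ θ′ ⟧ᵃ a
      ⟦⟧ᵃ-cong (rel r ts) eq = cong (relᴵ r) (⟦⟧ᵗˢ-cong ts eq)
      ⟦⟧ᵃ-cong (t ≐ u)    eq =
        cong₂ _≡_ (⟦⟧ᵗ-cong t (eq ∘ ∈-++⁺ˡ)) (⟦⟧ᵗ-cong u (eq ∘ ∈-++⁺ʳ (termVars t)))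

      ⊩-cong : ∀ φ → (∀ {y} → y ∈ vars φ → θ y ≡ θ′ y) → (θ ⊩ φ) ≡ (θ′ ⊩ φ)
      ⊩-cong φ eq = Holds-cong φ λ {a} a∈ → ⟦⟧ᵃ-cong a λ {y} y∈ →
        eq (∈-concatMap⁺ atomVars {xs = atoms φ} (Any.map (λ { refl → y∈ }) a∈))

    module _ {V W : Set} (f : V → W) {θ : W → Carrier} where

      mutual
        ⟦⟧ᵗ-rename : ∀ t → ⟦ θ ⟧ᵗ (renameTerm f t) ≡ ⟦ θ ∘ f ⟧ᵗ t
        ⟦⟧ᵗ-rename (var y)    = refl
        ⟦⟧ᵗ-rename (app g ts) = cong (funᴵ g) (⟦⟧ᵗˢ-rename ts)

        ⟦⟧ᵗˢ-rename : ∀ {n} (ts : Vec (Term V) n) →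
                      ⟦ θ ⟧ᵗˢ (renameTerms f ts) ≡ ⟦ θ ∘ f ⟧ᵗˢ ts
        ⟦⟧ᵗˢ-rename []       = refl
        ⟦⟧ᵗˢ-rename (t ∷ ts) = cong₂ _∷_ (⟦⟧ᵗ-rename t) (⟦⟧ᵗˢ-rename ts)

      ⟦⟧ᵃ-rename : ∀ a → ⟦ θ ⟧ᵃ (renameAtom f a) ≡ ⟦ θ ∘ f ⟧ᵃ a
      ⟦⟧ᵃ-rename (rel r ts) = cong (relᴵ r) (⟦⟧ᵗˢ-rename ts)
      ⟦⟧ᵃ-rename (t ≐ u)    = cong₂ _≡_ (⟦⟧ᵗ-rename t) (⟦⟧ᵗ-rename u)

      ⊩-rename : ∀ φ → (θ ⊩ rename f φ) ≡ (θ ∘ f ⊩ φ)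
      ⊩-rename φ = trans (Holds-mapᶠ (renameAtom f) φ)
                         (Holds-cong φ λ {a} _ → ⟦⟧ᵃ-rename a)

-- Formulas under partial valuations.

module _ {Sg : Signature} (𝒜 : Theory Sg) (d : ℕ) where
  open Syntax Sg
  open Theory 𝒜
  open Setting 𝒜 d

  -- Overwriting `θ` by `σ` wherever `σ` is defined gives an extension of `σ`, hence a model of `φ`.
  -- On `vars φ`, where `σ` is defined throughout, nothing changes.
  ⊨-agree : ∀ {σ} φ {θ : Var → Carrier} → σ ⊨ φ →
            (∀ {y c} → y ∈ vars φ → σ y ≡ just c → θ y ≡ c) → θ ⊩ φ
  ⊨-agree {σ} φ {θ} (dom , holds) agree =
    subst id (⊩-cong structure φ eq) (holds (λ y → fromMaybe (θ y) (σ y)) ext)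
    where
    ext : (λ y → fromMaybe (θ y) (σ y)) extends σ
    ext y c e rewrite e = refl

    eq : ∀ {y} → y ∈ vars φ → fromMaybe (θ y) (σ y) ≡ θ y
    eq {y} y∈ with c , e ← dom y y∈ = trans (ext y c e) (sym (agree y∈ e))

  ⊨-rename : ∀ {σ σ′} (f : Var → Var) φ → σ ⊨ φ →
             (∀ {y} → y ∈ vars φ → σ′ (f y) ≡ σ y) → σ′ ⊨ rename f φ
  ⊨-rename {σ} {σ′} f φ σ⊨φ eq = dom , holds
    where
    dom : ∀ z → z ∈ vars (rename f φ) → z ∈dom σ′
    dom z z∈ with y , y∈ , refl ← ∈-vars-rename⁻ f φ z∈
             with c , e ← proj₁ σ⊨φ y y∈ = c , trans (eq y∈) e

    holds : ∀ θ → θ extends σ′ → θ ⊩ rename f φ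
    holds θ ext = subst id (sym (⊩-rename structure f φ))
      (⊨-agree φ σ⊨φ λ {y} {c} y∈ e → ext (f y) c (trans (eq y∈) e))

  ⊨-∧ : ∀ {σ} φ ψ → σ ⊨ φ → σ ⊨ ψ → σ ⊨ φ ∧ᶠ ψ
  ⊨-∧ {σ} φ ψ (dom₁ , holds₁) (dom₂ , holds₂) = dom , λ θ e → holds₁ θ e , holds₂ θ e
    where
    dom : ∀ y → y ∈ vars (φ ∧ᶠ ψ) → y ∈dom σ
    dom y y∈ with ∈-++⁻ (vars φ) (subst (y ∈_) (concatMap-++ atomVars (atoms φ) (atoms ψ)) y∈)
    ... | inj₁ y∈φ = dom₁ y y∈φ
    ... | inj₂ y∈ψ = dom₂ y y∈ψ

  -- Assertions under total valuations

  Sat : (Var → Carrier) → (ℕ → ℕ) → Assertion → Set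
  Sat θ κ = Holds [ ⟦ θ ⟧ᵃ , ⟦ κ ⟧ⁱ ]′

  Sat-⌜rename⌝ : ∀ {θ κ} (f : Var → Var) (φ : Formula) → Sat θ κ ⌜ rename f φ ⌝ ≡ (θ ∘ f ⊩ φ)
  Sat-⌜rename⌝ f φ = trans (Holds-mapᶠ inj₁ (rename f φ)) (⊩-rename structure f φ)

  ⟦⟧ⁱ-cong : ∀ {κ κ′} a → (∀ i → κ i ≡ κ′ i) → ⟦ κ ⟧ⁱ a ≡ ⟦ κ′ ⟧ⁱ a
  ⟦⟧ⁱ-cong (xid i ≐ n)    eq = cong (_≡ n) (eq i)
  ⟦⟧ⁱ-cong (xid i ≐xid j) eq = cong₂ _≡_ (eq i) (eq j)
  ⟦⟧ⁱ-cong (xid i > n)    eq = cong (_> n) (eq i)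

  total : (Var → Carrier) → (ℕ → ℕ) → Model
  total θ κ = record { val = just ∘ θ ; ids = just ∘ κ }

  -- Up to pointwise equality, a total valuation is its own only extension.
  Sat⇒⊨ˢ : ∀ {θ κ} φ → Sat θ κ φ → total θ κ ⊨ˢ φ
  Sat⇒⊨ˢ {θ} {κ} φ sat = record
    { val-dom = λ y _ → θ y , refl
    ; ids-dom = λ i _ → κ i , refl
    ; holds   = λ θ′ κ′ eθ eκ → subst id (Holds-cong φ
        λ { {inj₁ a} _ → ⟦⟧ᵃ-cong structure a λ {y} _ → sym (eθ y (θ y) refl)
          ; {inj₂ a} _ → ⟦⟧ⁱ-cong a λ i → sym (eκ i (κ i) refl) }) sat
    }

  All-Sat⇒CheckSat : ∀ {θ κ} S → All (Sat θ κ) (Solver.assertions S) → CheckSat S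
  All-Sat⇒CheckSat {θ} {κ} S sats = total θ κ , All.map (λ {φ} → Sat⇒⊨ˢ φ) sats

  -- Lists counted from 1

  module _ {A : Set} where

    ‼-∷ʳ⁺ : ∀ {xs : List A} {x y} k → xs ‼ suc k ≡ just y → (xs ∷ʳ x) ‼ suc k ≡ just y
    ‼-∷ʳ⁺ {_ ∷ _}  zero    e = e
    ‼-∷ʳ⁺ {_ ∷ xs} (suc k) e = ‼-∷ʳ⁺ {xs} k e

    ‼-∷ʳ⁻ : ∀ (xs : List A) {x y} k → (xs ∷ʳ x) ‼ suc k ≡ just y →
            xs ‼ suc k ≡ just y ⊎ x ≡ y
    ‼-∷ʳ⁻ []       zero    e = inj₂ (just-injective e)
    ‼-∷ʳ⁻ (_ ∷ _)  zero    e = inj₁ e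
    ‼-∷ʳ⁻ (_ ∷ xs) (suc k) e = ‼-∷ʳ⁻ xs k e

    ∈⇒‼ : ∀ {xs : List A} {x} → x ∈ xs → ∃[ k ] xs ‼ suc k ≡ just x
    ∈⇒‼ (here refl) = 0 , refl
    ∈⇒‼ (there x∈) with k , e ← ∈⇒‼ x∈ = suc k , e

    ∈-tail⇒‼ : ∀ (xs : List A) {x} → x ∈ tail xs → ∃[ k ] xs ‼ suc (suc k) ≡ just x
    ∈-tail⇒‼ (_ ∷ xs) x∈ = ∈⇒‼ x∈

  -- The renamings of a loop

  Pre∪Post : Formula → Set
  Pre∪Post φ = ∀ y → y ∈ vars φ → x∪x′ y ≡ true

  -- Copies number `s` and `s + ℓ` turn into pre- and post-variables, which `μ s ℓ` sends back; the
  -- copies strictly between are fixed by both maps.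
  μ-loop-μ⁻¹ : ∀ {s ℓ i} k → 1 ≤ ℓ → s ≤ i → i ≤ s + ℓ →
               μ-loop s ℓ (μ⁻¹ s ℓ (pre k ⁽ i ⁾)) ≡ pre k ⁽ i ⁾
  μ-loop-μ⁻¹ {s} {ℓ} {i} k 1≤ℓ s≤i i≤s+ℓ with i ≟ s + ℓ | i ≟ s
  ... | yes refl | _ = cong (μ-loop s ℓ) (if-T (≡⇒≡ᵇ (s + ℓ) (s + ℓ) refl))
  ... | no i≢s+ℓ | yes refl =
    cong (μ-loop s ℓ) (trans (if-¬T (i≢s+ℓ ∘ ≡ᵇ⇒≡ s (s + ℓ))) (if-T (≡⇒≡ᵇ s s refl)))
  ... | no i≢s+ℓ | no i≢s =
    trans (cong (μ-loop s ℓ)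
            (trans (if-¬T (i≢s+ℓ ∘ ≡ᵇ⇒≡ i (s + ℓ))) (if-¬T (i≢s ∘ ≡ᵇ⇒≡ i s))))
          (if-T (Equivalence.from T-∧
            (<⇒<ᵇ (≤∧≢⇒< s≤i (i≢s ∘ sym)) , <⇒<ᵇ (≤∧≢⇒< i≤s+ℓ i≢s+ℓ))))

  -- What `cvp′` guarantees of the trace element of level `i`. A chain of such elements is an
  -- admissible argument of `tp`.
  record Transition (σ : Valuation) (i : ℕ) (φ : Formula) : Set where
    field
      conjunctive : Conjunctive φ
      pre∪post    : Pre∪Post φ
      model       : (σ ∘ μ i 1) ⊨ φ

  data Transitions (σ : Valuation) : ℕ → List Formula → Set where
    []  : ∀ {i} → Transitions σ i []
    _∷_ : ∀ {i φ φs} → Transition σ i φ → Transitions σ (suc i) φs →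
          Transitions σ i (φ ∷ φs)

  module _ {σ : Valuation} where
    open Transition

    Transitions-take : ∀ {i φs} ℓ → Transitions σ i φs → Transitions σ i (take ℓ φs)
    Transitions-take zero    _        = []
    Transitions-take (suc ℓ) []       = []
    Transitions-take (suc ℓ) (t ∷ ts) = t ∷ Transitions-take ℓ ts

    Transitions-drop : ∀ {i φs} m → Transitions σ i φs → Transitions σ (m + i) (drop m φs)
    Transitions-drop zero    ts       = ts
    Transitions-drop (suc m) []       = []
    Transitions-drop {i} {_ ∷ φs} (suc m) (t ∷ ts) =
      subst (λ j → Transitions σ j (drop m φs)) (+-suc m i) (Transitions-drop m ts)

    chain-conjunctive : ∀ {i φs} → Transitions σ i φs → Conjunctive (chain i φs)
    chain-conjunctive []       = top
    chain-conjunctive (t ∷ ts) =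
      and (Conjunctive-mapᶠ _ (conjunctive t)) (chain-conjunctive ts)

    chain-model : ∀ {i φs} → Transitions σ i φs → σ ⊨ chain i φs
    chain-model [] = (λ _ ()) , λ _ _ → tt
    chain-model {i} {φ ∷ φs} (t ∷ ts) =
      ⊨-∧ (rename (μ i 1) φ) (chain (suc i) φs)
          (⊨-rename (μ i 1) φ (model t) λ _ → refl) (chain-model ts)

    -- Step `j` mentions only its pre-state, in copies `j`, and its post-state, which `μ j 1` stores
    -- in the copies `j + 1` of pre-variables. So `μ-loop-μ⁻¹` covers every variable of a chain.
    chain-vars : ∀ {i φs} ℓ → Transitions σ i φs → ∀ {z} → z ∈ vars (chain i (take ℓ φs)) →
                 ∃[ k ] ∃[ j ] z ≡ pre k ⁽ j ⁾ × i ≤ j × j ≤ i + ℓ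
    chain-vars zero    _  ()
    chain-vars (suc ℓ) [] ()
    chain-vars {i} {φ ∷ φs} (suc ℓ) (t ∷ ts) {z} z∈
      with ∈-++⁻ (vars (rename (μ i 1) φ))
             (subst (z ∈_) (concatMap-++ atomVars (atoms (rename (μ i 1) φ)) _) z∈)
    ... | inj₂ z∈φs with k , j , eq , i<j , j≤ ← chain-vars ℓ ts z∈φs =
      k , j , eq , <⇒≤ i<j , ≤-trans j≤ (≤-reflexive (sym (+-suc i ℓ)))
    ... | inj₁ z∈φ with ∈-vars-rename⁻ (μ i 1) φ z∈φ
    ...   | pre k , y∈ , refl  = k , i , refl , ≤-refl , m≤m+n i (suc ℓ)
    ...   | post k , y∈ , refl = k , i + 1 , refl , m≤m+n i 1 , +-monoʳ-≤ i (s≤s z≤n)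
    ...   | extra n , y∈ , refl with () ← pre∪post t _ y∈
    ...   | y ⁽ n ⁾ , y∈ , refl with () ← pre∪post t _ y∈

  valVars : Assertion → List Var
  valVars φ = concatMap [ atomVars , (λ _ → []) ]′ (atoms φ)

  valVars-⌜⌝ : ∀ φ → valVars ⌜ φ ⌝ ≡ vars φ
  valVars-⌜⌝ φ = trans (cong (concatMap [ atomVars , (λ _ → []) ]′) (atoms-mapᶠ inj₁ φ))
                       (concatMap-map [ atomVars , (λ _ → []) ]′ inj₁ (atoms φ))

  module _ {A B : Set} (f : A → List B) where

    ∈-concatMap-++⁺ˡ : ∀ {z} xs {ys} → z ∈ concatMap f xs → z ∈ concatMap f (xs ++ ys)
    ∈-concatMap-++⁺ˡ xs {ys} z∈ = subst (_ ∈_) (sym (concatMap-++ f xs ys)) (∈-++⁺ˡ z∈)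

    ∈-concatMap-++⁺ʳ : ∀ {z} xs {ys} → z ∈ concatMap f ys → z ∈ concatMap f (xs ++ ys)
    ∈-concatMap-++⁺ʳ xs {ys} z∈ =
      subst (_ ∈_) (sym (concatMap-++ f xs ys)) (∈-++⁺ʳ (concatMap f xs) z∈)

  infix 4 _⊑_

  -- Positions matter, not just membership: an id chosen for the shorter list denotes the same
  -- relation in the longer one.
  _⊑_ : List Formula → List Formula → Set
  ρ ⊑ ρ′ = ∀ {k π} → ρ ‼ suc k ≡ just π → ρ′ ‼ suc k ≡ just π

  module _ (T : SafetyProblem)
           (cvp : Formula → Valuation → VarSet → Formula)
           (cvp-proj : IsConjunctiveVariableProjection cvp)
           (tp : Formula → Valuation → Formula)
           (tp-proj : IsTransitiveProjection tp) where
    open SafetyProblem T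
    open TRL T cvp tp
    open Solver
    module CVP = IsConjunctiveVariableProjection cvp-proj
    module TP = IsTransitiveProjection tp-proj

    -- The assertions of a level

    assertions-foldr-add : ∀ S cs → assertions (foldr add S cs) ≡ cs ++ assertions S
    assertions-foldr-add S []       = refl
    assertions-foldr-add S (c ∷ cs) = cong (c ∷_) (assertions-foldr-add S cs)

    saved-foldr-add : ∀ S cs → saved (foldr add S cs) ≡ saved S
    saved-foldr-add S []       = refl
    saved-foldr-add S (c ∷ cs) = saved-foldr-add S cs

    idConstraint : ℕ → List Assertion
    idConstraint i =
      if 1 <ᵇ i then [ idAtom (xid i ≐ 1) ∨ᶠ ¬ᶠ idAtom (xid i ≐xid (i ∸ 1)) ] else []

    assertions-addId : ∀ i S → assertions (addIdConstraint i S) ≡ idConstraint i ++ assertions S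
    assertions-addId i S with 1 <ᵇ i
    ... | true  = refl
    ... | false = refl

    saved-addId : ∀ i S → saved (addIdConstraint i S) ≡ saved S
    saved-addId i S with 1 <ᵇ i
    ... | true  = refl
    ... | false = refl

    levelAssertions : ℕ → List Formula → List (ℕ × Assertion) → List Assertion
    levelAssertions i π⃗ blocked = blockedAt i blocked ++ disjunction i 1 π⃗ ∷ idConstraint i

    assertions-unroll : ∀ i π⃗ blocked S → assertions (unroll i π⃗ blocked S) ≡
                        levelAssertions i π⃗ blocked ++ assertions S
    assertions-unroll i π⃗ blocked S = begin
      assertions (unroll i π⃗ blocked S)
        ≡⟨ assertions-foldr-add _ (blockedAt i blocked) ⟩
      blockedAt i blocked ++ disjunction i 1 π⃗ ∷ assertions (addIdConstraint i (push S))
        ≡⟨ cong (λ φs → blockedAt i blocked ++ disjunction i 1 π⃗ ∷ φs)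
                (assertions-addId i (push S)) ⟩
      blockedAt i blocked ++ (disjunction i 1 π⃗ ∷ idConstraint i) ++ assertions S
        ≡⟨ ++-assoc (blockedAt i blocked) _ _ ⟨
      levelAssertions i π⃗ blocked ++ assertions S ∎
      where open ≡-Reasoning

    pop-saved : ∀ S {φs ss} → saved S ≡ φs ∷ ss → pop S ≡ solver φs ss
    pop-saved (solver _ _) refl = refl

    -- `unroll` pushes once, at its start, and `add` leaves the saved assertions alone.
    pop-unroll : ∀ i π⃗ blocked S → pop (unroll i π⃗ blocked S) ≡ S
    pop-unroll i π⃗ blocked S = pop-saved (unroll i π⃗ blocked S)
      (trans (saved-foldr-add _ (blockedAt i blocked)) (saved-addId i (push S)))

    -- The solver rebuilt from scratch with the current `blocked`. This is faithful because a new
    -- clause always belongs to a level above those that survive the backtracking.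
    build : (ℕ → List Formula) → List (ℕ × Assertion) → ℕ → Solver
    build ρ blocked zero    = State.smt initial
    build ρ blocked (suc i) = unroll (suc i) (ρ (suc i)) blocked (build ρ blocked i)

    build-cong : ∀ {ρ ρ′ blocked blocked′} i → (∀ {j} → j ≤ i → ρ j ≡ ρ′ j) →
                 (∀ {j} → j ≤ i → blockedAt j blocked ≡ blockedAt j blocked′) →
                 build ρ blocked i ≡ build ρ′ blocked′ i
    build-cong zero    _  _ = refl
    build-cong {ρ} {ρ′} {blocked} {blocked′} (suc i) eq₁ eq₂
      rewrite eq₁ (≤-refl {suc i}) | eq₂ (≤-refl {suc i})
      = cong (unroll (suc i) (ρ′ (suc i)) blocked′)
             (build-cong {blocked = blocked} {blocked′} i
               (λ j≤i → eq₁ (m≤n⇒m≤1+n j≤i)) (λ j≤i → eq₂ (m≤n⇒m≤1+n j≤i)))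

    backtrack-below : ∀ t S → backtrack (suc t) t S ≡ (t , S)
    backtrack-below zero    S = refl
    backtrack-below (suc t) S = if-¬T (λ p → <-irrefl refl (<ᵇ⇒< (suc t) (suc t) p))

    backtrack-build : ∀ ρ blocked t m →
                      backtrack (suc t) (m + t) (build ρ blocked (m + t)) ≡ (t , build ρ blocked t)
    backtrack-build ρ blocked t zero    = backtrack-below t _
    backtrack-build ρ blocked t (suc m) = begin
      backtrack (suc t) (suc (m + t)) (build ρ blocked (suc (m + t)))
        ≡⟨ if-T (≤⇒≤ᵇ (s≤s (m≤n+m t m))) ⟩
      backtrack (suc t) (m + t) (pop (build ρ blocked (suc (m + t))))
        ≡⟨ cong (backtrack (suc t) (m + t)) (pop-unroll (suc (m + t)) _ blocked _) ⟩
      backtrack (suc t) (m + t) (build ρ blocked (m + t))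
        ≡⟨ backtrack-build ρ blocked t m ⟩
      (t , build ρ blocked t) ∎
      where open ≡-Reasoning

    disjunction⁻ : ∀ {θ κ i} m πs → Sat θ κ (disjunction i m πs) →
                   ∃[ k ] ∃[ π ] πs ‼ suc k ≡ just π × κ i ≡ m + k × θ ∘ μ i 1 ⊩ π
    disjunction⁻ m []       ¬t = ⊥-elim (¬t tt)
    disjunction⁻ {i = i} m (π ∷ πs) (inj₁ (h , e)) =
      0 , π , refl , trans e (sym (+-identityʳ m)) , subst id (Sat-⌜rename⌝ (μ i 1) π) h
    disjunction⁻ m (π ∷ πs) (inj₂ h) with k , π′ , at , e , h′ ← disjunction⁻ (suc m) πs h =
      suc k , π′ , at , trans e (sym (+-suc m k)) , h′

    disjunction⁺ : ∀ {θ κ i} m πs k {π} → πs ‼ suc k ≡ just π → κ i ≡ m + k → θ ∘ μ i 1 ⊩ π →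
                   Sat θ κ (disjunction i m πs)
    disjunction⁺ {i = i} m (π ∷ πs) zero refl e h =
      inj₁ (subst id (sym (Sat-⌜rename⌝ (μ i 1) π)) h , trans e (+-identityʳ m))
    disjunction⁺ m (π ∷ πs) (suc k) at e h =
      inj₂ (disjunction⁺ (suc m) πs k at (trans e (+-suc m k)) h)

    disjunction-valVars : ∀ {i y} m πs k {π} → πs ‼ suc k ≡ just π → y ∈ vars π →
                          μ i 1 y ∈ valVars (disjunction i m πs)
    disjunction-valVars {i} m (π ∷ πs) zero refl y∈ =
      ∈-concatMap-++⁺ˡ _ (atoms (⌜ rename (μ i 1) π ⌝ ∧ᶠ idAtom (xid i ≐ m)))
        (∈-concatMap-++⁺ˡ _ (atoms ⌜ rename (μ i 1) π ⌝)
          (subst (_ ∈_) (sym (valVars-⌜⌝ (rename (μ i 1) π))) (∈-vars-rename⁺ (μ i 1) π y∈)))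
    disjunction-valVars {i} m (π ∷ πs) (suc k) at y∈ =
      ∈-concatMap-++⁺ʳ _ (atoms (⌜ rename (μ i 1) π ⌝ ∧ᶠ idAtom (xid i ≐ m)))
        (disjunction-valVars (suc m) πs k at y∈)

    disjunction-idVars : ∀ {i} m πs k {π : Formula} → πs ‼ suc k ≡ just π →
                         i ∈ concatMap [ (λ _ → []) , idVars ]′ (atoms (disjunction i m πs))
    disjunction-idVars {i} m (π ∷ πs) k _ =
      ∈-concatMap-++⁺ˡ _ (atoms (⌜ rename (μ i 1) π ⌝ ∧ᶠ idAtom (xid i ≐ m)))
        (∈-concatMap-++⁺ʳ _ (atoms ⌜ rename (μ i 1) π ⌝) (here refl))

    idConstraint⁺ : ∀ {θ κ} i → (1 < i → κ i ≡ 1 ⊎ κ i ≢ κ (i ∸ 1)) →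
                    All (Sat θ κ) (idConstraint i)
    idConstraint⁺ zero          _ = []
    idConstraint⁺ (suc zero)    _ = []
    idConstraint⁺ (suc (suc i)) h = h (s≤s (s≤s z≤n)) ∷ []

    -- Models of the assertions

    record Selected (M : Model) (i : ℕ) (πs : List Formula) : Set where
      open Model M
      field
        k     : ℕ
        π     : Formula
        at    : πs ‼ suc k ≡ just π
        id-is : ids i ≡ just (suc k)
        model : (val ∘ μ i 1) ⊨ π

    -- Completing `M` by default values picks a disjunct. All variables of the disjunction are in
    -- the domain of `M`, so neither the id nor the truth of that disjunct depends on the
    -- completion.
    disjunction-selects : ∀ {M i πs} → M ⊨ˢ disjunction i 1 πs → Selected M i πs
    disjunction-selects {M} {i} {πs} M⊨
      with k , π , at , κi≡ , _ ← disjunction⁻ 1 πs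
             (_⊨ˢ_.holds M⊨ (fromMaybe point ∘ Model.val M) (fromMaybe 0 ∘ Model.ids M)
               (λ y c e → cong (fromMaybe point) e) (λ j n e → cong (fromMaybe 0) e))
      with n , e ← _⊨ˢ_.ids-dom M⊨ i (disjunction-idVars 1 πs k at)
      = record { k = k ; π = π ; at = at ; id-is = ids-i ; model = dom , holds′ }
      where
      open Model M
      open _⊨ˢ_ M⊨

      ids-i : ids i ≡ just (suc k)
      ids-i = trans e (cong just (trans (sym (cong (fromMaybe 0) e)) κi≡))

      dom : ∀ y → y ∈ vars π → y ∈dom (val ∘ μ i 1)
      dom y y∈ = val-dom (μ i 1 y) (disjunction-valVars 1 πs k at y∈)

      holds′ : ∀ θ → θ extends (val ∘ μ i 1) → θ ⊩ π
      holds′ θ ext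
        with k′ , π′ , at′ , κi≡′ , h ← disjunction⁻ 1 πs
               (holds (fromMaybe point ∘ val) (fromMaybe 0 ∘ ids)
                 (λ y c e → cong (fromMaybe point) e) (λ j n e → cong (fromMaybe 0) e))
        -- The id is both `1 + k′` and `1 + k`, so this is the disjunct already chosen.
        with refl ← suc-injective (trans (sym κi≡′) κi≡)
        with refl ← just-injective (trans (sym at′) at)
        = subst id (⊩-cong structure π agree) h
        where
        agree : ∀ {y} → y ∈ vars π → fromMaybe point (val (μ i 1 y)) ≡ θ y
        agree {y} y∈ with c , e ← dom y y∈ = trans (cong (fromMaybe point) e) (sym (ext y c e))

    module _ {M : Model} where
      open Model M

      cvp′-transition : ∀ {i} π → (val ∘ μ i 1) ⊨ π → Transition val i (cvp′ π (val ∘ μ i 1))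
      cvp′-transition π σ⊨π = record
        { conjunctive = CVP.conjunctive π x∪x′ _ σ⊨π
        ; pre∪post    = λ y y∈ → proj₁ (CVP.variables π x∪x′ _ σ⊨π y y∈)
        ; model       = CVP.model π x∪x′ _ σ⊨π
        }

      traceAt-selected : ∀ {i π⃗} (sel : Selected M i π⃗) →
                         traceAt M π⃗ i ≡ just (cvp′ (Selected.π sel) (val ∘ μ i 1))
      traceAt-selected sel rewrite Selected.id-is sel | Selected.at sel = refl

      -- Generalised to any `f` that counts from `i`, since `applyUpTo` recurses on `f ∘ suc`. As
      -- `traceAt` is defined on all these levels, `mapMaybe` drops nothing and each trace element
      -- keeps its level.
      trace-transitions : ∀ {π⃗} f n i → (∀ m → f m ≡ m + i) →
                          (∀ {j} → i ≤ j → j < n + i → Selected M j π⃗) →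
                          Transitions val i (mapMaybe (traceAt M π⃗) (applyUpTo f n))
      trace-transitions f zero    i _  _ = []
      trace-transitions {π⃗} f (suc n) i eq sel
        rewrite eq 0 | traceAt-selected (sel ≤-refl (s≤s (m≤n+m i n)))
        = cvp′-transition (Selected.π selᵢ) (Selected.model selᵢ)
        ∷ trace-transitions (f ∘ suc) n (suc i) (λ m → trans (eq (suc m)) (sym (+-suc m i)))
            (λ i<j j< → sel (<⇒≤ i<j) (≤-trans j< (≤-reflexive (+-suc n i))))
        where selᵢ = sel ≤-refl (s≤s (m≤n+m i n))

      -- The chain is a conjunction with model `val`. On its variables `μ-loop s ℓ` undoes
      -- `μ⁻¹ s ℓ`, so `val ∘ μ-loop s ℓ` is a model of `τ-loop` and the transitivity law of `tp`
      -- applies.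
      learned-transitive : ∀ {τs} s ℓ → 1 ≤ s → 1 ≤ ℓ → Transitions val 1 τs →
        Transitive (λ u w → u -[ tp (τ-loop τs s ℓ) (val ∘ μ-loop s ℓ) ]→ w)
      learned-transitive {τs} s@(suc t) ℓ 1≤s 1≤ℓ ts =
        TP.transitive (τ-loop τs s ℓ) (Conjunctive-mapᶠ _ (chain-conjunctive seg)) _
          (⊨-rename (μ⁻¹ s ℓ) (chain s (segment s ℓ τs)) (chain-model seg) inverse)
        where
        rest : Transitions val s (drop t τs)
        rest = subst (λ j → Transitions val j (drop t τs)) (+-comm t 1) (Transitions-drop t ts)

        seg : Transitions val s (segment s ℓ τs)
        seg = Transitions-take ℓ rest

        inverse : ∀ {z} → z ∈ vars (chain s (segment s ℓ τs)) →
                  val (μ-loop s ℓ (μ⁻¹ s ℓ z)) ≡ val z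
        inverse z∈ with k , j , refl , s≤j , j≤ ← chain-vars ℓ rest z∈ =
          cong val (μ-loop-μ⁻¹ k 1≤ℓ s≤j j≤)

    -- Blocking clauses

    -- With its converse, this gives both shapes of a blocking clause one reading, so that later
    -- arguments need no case split on `ℓ`.
    blockingClause⁺ : ∀ {θ κ} s ℓ π σ̄ →
                      ¬ (θ ∘ μ s ℓ ⊩ cvp′ π σ̄) ⊎ (ℓ ≡ 1 × κ s > 1) →
                      Sat θ κ (blockingClause s ℓ π σ̄)
    blockingClause⁺ s 0 π σ̄ (inj₁ h) = h ∘ subst id (Sat-⌜rename⌝ (μ s 0) (cvp′ π σ̄))
    blockingClause⁺ s 1 π σ̄ (inj₁ h) = inj₁ (h ∘ subst id (Sat-⌜rename⌝ (μ s 1) (cvp′ π σ̄)))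
    blockingClause⁺ s 1 π σ̄ (inj₂ (_ , h)) = inj₂ h
    blockingClause⁺ s ℓ@(suc (suc _)) π σ̄ (inj₁ h) =
      h ∘ subst id (Sat-⌜rename⌝ (μ s ℓ) (cvp′ π σ̄))

    blockingClause⁻ : ∀ {θ κ} s ℓ π σ̄ → Sat θ κ (blockingClause s ℓ π σ̄) →
                      ¬ (θ ∘ μ s ℓ ⊩ cvp′ π σ̄) ⊎ (ℓ ≡ 1 × κ s > 1)
    blockingClause⁻ s 0 π σ̄ h = inj₁ (h ∘ subst id (sym (Sat-⌜rename⌝ (μ s 0) (cvp′ π σ̄))))
    blockingClause⁻ s 1 π σ̄ (inj₁ h) =
      inj₁ (h ∘ subst id (sym (Sat-⌜rename⌝ (μ s 1) (cvp′ π σ̄))))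
    blockingClause⁻ s 1 π σ̄ (inj₂ h) = inj₂ (refl , h)
    blockingClause⁻ s ℓ@(suc (suc _)) π σ̄ h =
      inj₁ (h ∘ subst id (sym (Sat-⌜rename⌝ (μ s ℓ) (cvp′ π σ̄))))

    -- The origin of a clause of level `j`. A shortcut with `π` is taken at level `s`, so `at`
    -- places `π` in the list of that level; the position `suc (suc k)` marks it as learned. The
    -- equation `s+ℓ≡1+j` avoids truncated subtraction.
    record Blocking (ρ : ℕ → List Formula) (j : ℕ) (c : Assertion) : Set where
      field
        s ℓ k   : ℕ
        π       : Formula
        σ̄       : Valuation
        1≤s     : 1 ≤ s
        1≤ℓ     : 1 ≤ ℓ
        s+ℓ≡1+j : s + ℓ ≡ suc j
        at      : ρ s ‼ suc (suc k) ≡ just π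
        model   : σ̄ ⊨ π
        form    : c ≡ blockingClause s ℓ π σ̄

    record Labelling (π⃗ : List Formula) (blocked : List (ℕ × Assertion)) : Set where
      field
        ρ          : ℕ → List Formula
        ρ-head     : ∀ i → ρ i ‼ 1 ≡ just τ
        ρ⊑π⃗        : ∀ i → ρ i ⊑ π⃗
        transitive : ∀ {k π} → π⃗ ‼ suc (suc k) ≡ just π →
                     Transitive (λ u w → u -[ π ]→ w)
        blocking   : ∀ {j c} → (j , c) ∈ blocked → Blocking ρ j c

    -- Models of the assertions as runs, level by level.

    module Runs {π⃗ : List Formula} {blocked : List (ℕ × Assertion)} (L : Labelling π⃗ blocked) where
      open Labelling L

      -- E i gives the values of the i-th copies of the variables.
      ⟪_⟫ : (ℕ → Var → Carrier) → Var → Carrier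
      ⟪ E ⟫ (y ⁽ i ⁾) = E i y
      ⟪ E ⟫ _         = point

      record Level (E : ℕ → Var → Carrier) (κ : ℕ → ℕ) (i : ℕ) : Set where
        field
          k         : ℕ
          π         : Formula
          at        : ρ i ‼ suc k ≡ just π
          id-is     : κ i ≡ suc k
          step      : ⟪ E ⟫ ∘ μ i 1 ⊩ π
          distinct  : 1 < i → κ i ≡ 1 ⊎ κ i ≢ κ (i ∸ 1)
          unblocked : ∀ {c} → c ∈ blockedAt i blocked → Sat ⟪ E ⟫ κ c

      record Run (E : ℕ → Var → Carrier) (κ : ℕ → ℕ) (i : ℕ) : Set where
        field
          start  : ⟪ E ⟫ ∘ μ 1 1 ⊩ init
          levels : ∀ {j} → 1 ≤ j → j ≤ i → Level E κ j

      open Level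
      open Run

      Run-≤ : ∀ {E κ i j} → j ≤ i → Run E κ i → Run E κ j
      Run-≤ j≤i r = record
        { start  = start r
        ; levels = λ 1≤ ≤j → levels r 1≤ (≤-trans ≤j j≤i)
        }

      blockedAt⁻ : ∀ {i c} → c ∈ blockedAt i blocked → Blocking ρ i c
      blockedAt⁻ {i} c∈ with (j , c) , p∈ , refl ← ∈-map⁻ proj₂ c∈
                        with p∈′ , refl ← ∈-filter⁻ (λ p → proj₁ p ≟ i) {xs = blocked} p∈
                        = blocking p∈′

      -- Levels up to `i` see the copies number `suc i` only through the end state, so the other
      -- variables of that copy may differ.
      record Agree (i : ℕ) (E E′ : ℕ → Var → Carrier) (κ κ′ : ℕ → ℕ) : Set where
        field
          env  : ∀ {j} → j ≤ i → E j ≡ E′ j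
          end  : ∀ k → E (suc i) (pre k) ≡ E′ (suc i) (pre k)
          kind : ∀ {j} → j ≤ i → κ j ≡ κ′ j

        pre-eq : ∀ {j} → j ≤ suc i → ∀ k → E j (pre k) ≡ E′ j (pre k)
        pre-eq j≤ k with m≤n⇒m<n∨m≡n j≤
        ... | inj₁ (s≤s j≤i) = cong (λ e → e (pre k)) (env j≤i)
        ... | inj₂ refl      = end k

      module _ {i : ℕ} {E E′ : ℕ → Var → Carrier} {κ κ′ : ℕ → ℕ} (A : Agree i E E′ κ κ′) where
        open Agree A

        μ-agree : ∀ {s ℓ} φ → s ≤ suc i → s + ℓ ≤ suc i → Pre∪Post φ →
                  (⟪ E ⟫ ∘ μ s ℓ ⊩ φ) ≡ (⟪ E′ ⟫ ∘ μ s ℓ ⊩ φ)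
        μ-agree {s} {ℓ} φ s≤ s+ℓ≤ X = ⊩-cong structure φ λ {y} y∈ → eq y (X y y∈)
          where
          eq : ∀ y → x∪x′ y ≡ true → ⟪ E ⟫ (μ s ℓ y) ≡ ⟪ E′ ⟫ (μ s ℓ y)
          eq (pre k)  _ = pre-eq s≤ k
          eq (post k) _ = pre-eq s+ℓ≤ k

        Level-agree : ∀ {j} → 1 ≤ j → j ≤ i → Level E κ j → Level E′ κ′ j
        Level-agree {j} 1≤j j≤i l = record
          { k         = k l
          ; π         = π l
          ; at        = at l
          ; id-is     = trans (sym (kind j≤i)) (id-is l)
          ; step      = subst id (⊩-cong structure (π l) λ {y} _ → eq y) (step l)
          ; distinct  = λ 1<j → subst₂ (λ a b → a ≡ 1 ⊎ a ≢ b) (kind j≤i)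
                                  (kind (≤-trans (m∸n≤m j 1) j≤i)) (distinct l 1<j)
          ; unblocked = λ c∈ → transfer (blockedAt⁻ c∈) (unblocked l c∈)
          }
          where
          eq : ∀ y → ⟪ E ⟫ (μ j 1 y) ≡ ⟪ E′ ⟫ (μ j 1 y)
          eq (pre k)   = pre-eq (m≤n⇒m≤1+n j≤i) k
          eq (post k)  = pre-eq (≤-trans (≤-reflexive (+-comm j 1)) (s≤s j≤i)) k
          eq (extra n) = cong (λ e → e (extra n)) (env j≤i)
          eq (y ⁽ n ⁾) = cong (λ e → e (y ⁽ n ⁾)) (env j≤i)

          transfer : ∀ {c} → Blocking ρ j c → Sat ⟪ E ⟫ κ c → Sat ⟪ E′ ⟫ κ′ c
          transfer record { s = s ; ℓ = ℓ ; π = π ; σ̄ = σ̄ ; 1≤ℓ = 1≤ℓ ; s+ℓ≡1+j = s+ℓ≡1+j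
                          ; model = σ̄⊨π ; form = refl } sat
            with blockingClause⁻ s ℓ π σ̄ sat
          ... | inj₂ (ℓ≡1 , κs>1) =
            blockingClause⁺ s ℓ π σ̄ (inj₂ (ℓ≡1 , subst (_> 1) (kind s≤i) κs>1))
            where
            s≤i : s ≤ i
            s≤i = ≤-pred (≤-trans (subst (suc s ≤_) s+ℓ≡1+j
                    (≤-trans (≤-reflexive (+-comm 1 s)) (+-monoʳ-≤ s 1≤ℓ))) (s≤s j≤i))
          ... | inj₁ ¬h = blockingClause⁺ s ℓ π σ̄ (inj₁ (¬h ∘ subst id (sym
            (μ-agree (cvp′ π σ̄) (≤-trans (m≤m+n s ℓ) s+ℓ≤) s+ℓ≤
              (λ y y∈ → proj₁ (CVP.variables π x∪x′ σ̄ σ̄⊨π y y∈))))))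
            where
            s+ℓ≤ : s + ℓ ≤ suc i
            s+ℓ≤ = ≤-trans (≤-reflexive s+ℓ≡1+j) (s≤s j≤i)

        Run-agree : Run E κ i → Run E′ κ′ i
        Run-agree r = record
          { start  = subst id (⊩-cong structure init λ {y} y∈ → eq (init-vars y y∈)) (start r)
          ; levels = λ 1≤j j≤i → Level-agree 1≤j j≤i (levels r 1≤j j≤i)
          }
          where
          eq : ∀ {y} → IsPre y → ⟪ E ⟫ (μ 1 1 y) ≡ ⟪ E′ ⟫ (μ 1 1 y)
          eq (pre k) = pre-eq (s≤s z≤n) k

      Run⇒All-Sat : ∀ {E κ} i → Run E κ i → All (Sat ⟪ E ⟫ κ) (assertions (build ρ blocked i))
      Run⇒All-Sat zero r = subst id (sym (Sat-⌜rename⌝ (μ 1 1) init)) (start r) ∷ []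
      Run⇒All-Sat {E} {κ} (suc i) r =
        subst (All (Sat ⟪ E ⟫ κ))
              (sym (assertions-unroll (suc i) (ρ (suc i)) blocked (build ρ blocked i)))
              (All.++⁺ (All.++⁺ (All.tabulate (unblocked l))
                                (disjunction⁺ 1 (ρ (suc i)) (k l) (at l) (id-is l) (step l) ∷
                                 idConstraint⁺ (suc i) (distinct l)))
                       (Run⇒All-Sat i (Run-≤ (n≤1+n i) r)))
        where
        l = levels r (s≤s z≤n) ≤-refl

      -- The copies number `suc i` hold the post-state of level `i`; for `i = 0` they hold the state
      -- constrained by `init`.
      record Reach (i : ℕ) (v : Tuple) : Set where
        field
          E   : ℕ → Var → Carrier
          κ   : ℕ → ℕ
          run : Run E κ i
          end : ∀ k → E (suc i) (pre k) ≡ lookup v k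

      extends-⟨_,_⟩ : ∀ {θ : Var → Carrier} {u v} → (∀ k → θ (pre k) ≡ lookup u k) →
                      (∀ k → θ (post k) ≡ lookup v k) → θ extends [x/ u ,x′/ v ]
      extends-⟨ p , q ⟩ (pre k)  _ refl = p k
      extends-⟨ p , q ⟩ (post k) _ refl = q k

      tupleAt : (ℕ → Var → Carrier) → ℕ → Tuple
      tupleAt E i = tabulate (λ k → E i (pre k))

      prefix : ∀ {E κ i} → Run E κ i → Reach i (tupleAt E (suc i))
      prefix {E} {κ} r = record
        { E = E ; κ = κ ; run = r ; end = λ k → sym (lookup∘tabulate _ k) }

      shift : (Var → Carrier) → Var → Carrier
      shift θ (pre k) = θ (post k)
      shift θ y       = θ y

      -- Extending a run by one step, and repairing violated constraints.

      module _ {v : Tuple} (unreachable : ∀ i → ¬ Reach i v) where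

        -- Common core of the two descents below. The run is extended by the step; every violated
        -- constraint yields a learned step into `v` that the first hypothesis excludes. Its side
        -- condition `i′ ≡ i → k ≡ 0` encodes the lexicographic order: a repair stays on the level
        -- only if it replaces `τ`, which has position one.
        step-to : ∀ i {k π u} →
          (∀ {i′ k′ π′ u′} → i′ ≤ i → (i′ ≡ i → k ≡ 0) → Reach i′ u′ →
           ρ (suc i′) ‼ suc (suc k′) ≡ just π′ → ¬ (u′ -[ π′ ]→ v)) →
          Reach i u → ρ (suc i) ‼ suc k ≡ just π → ¬ (u -[ π ]→ v)
        step-to i {k} {π} {u} learned R at u→v@(θ , ext , θ⊩π) = case-distinct i k refl refl
          where
          open Reach R renaming (E to E₀; κ to κ₀)

          E : ℕ → Var → Carrier
          -- The step supplies the copies of level `suc i`, and its post-state becomes the pre-state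
          -- of the copies after it.
          E = splice (suc i) E₀ θ (shift θ)

          κ : ℕ → ℕ
          -- The value 0 is a filler above the last level.
          κ = splice (suc i) κ₀ (suc k) 0

          E-old : ∀ {j} → j ≤ i → E₀ j ≡ E j
          E-old j≤i = sym (splice-< (s≤s j≤i))

          E-new : E (suc i) ≡ θ
          E-new = splice-≡ {m = suc i} {E₀}

          E-next : ∀ {j} → suc i < j → E j ≡ shift θ
          E-next = splice-> {f = E₀}

          κ-new : κ (suc i) ≡ suc k
          κ-new = splice-≡ {m = suc i} {κ₀}

          E-end : ∀ k → E (suc (suc i)) (pre k) ≡ lookup v k
          E-end k = trans (cong (λ e → e (pre k)) (E-next ≤-refl)) (ext (post k) _ refl)

          agree : Agree i E₀ E κ₀ κ
          agree = record
            { env  = E-old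
            ; end  = λ k → trans (end k) (trans (sym (ext (pre k) _ refl))
                                                (cong (λ e → e (pre k)) (sym E-new)))
            ; kind = λ j≤i → sym (splice-< (s≤s j≤i))
            }

          run′ : Run E κ i
          run′ = Run-agree agree run

          step′ : ⟪ E ⟫ ∘ μ (suc i) 1 ⊩ π
          step′ = subst id (⊩-cong structure π λ {y} _ → eq y) θ⊩π
            where
            eq : ∀ y → θ y ≡ ⟪ E ⟫ (μ (suc i) 1 y)
            eq (pre k)   = cong (λ e → e (pre k)) (sym E-new)
            eq (post k)  = cong (λ e → e (pre k))
                             (sym (E-next (≤-reflexive (cong suc (+-comm 1 i)))))
            eq (extra n) = cong (λ e → e (extra n)) (sym E-new)
            eq (y ⁽ n ⁾) = cong (λ e → e (y ⁽ n ⁾)) (sym E-new)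

          -- Were the clause violated, the blocked projection would hold between the state at
          -- `suc t` and `v`. It entails `π′`, so a learned step would lead to `v` from a state
          -- reached at level `t`.
          ¬¬unblocked : ∀ {c} → Blocking ρ (suc i) c → ¬ ¬ Sat ⟪ E ⟫ κ c
          ¬¬unblocked record { s = suc t ; ℓ = ℓ ; k = k′ ; π = π′ ; σ̄ = σ̄ ; 1≤ℓ = 1≤ℓ
                             ; s+ℓ≡1+j = s+ℓ≡ ; at = at′ ; model = σ̄⊨π′ ; form = refl } ¬sat =
            ¬sat (blockingClause⁺ (suc t) ℓ π′ σ̄ (inj₁ segment-free))
            where
            t+ℓ≡1+i : t + ℓ ≡ suc i
            t+ℓ≡1+i = suc-injective s+ℓ≡

            t≤i : t ≤ i
            t≤i = ≤-pred (subst (suc t ≤_) t+ℓ≡1+i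
                    (≤-trans (≤-reflexive (+-comm 1 t)) (+-monoʳ-≤ t 1≤ℓ)))

            -- A segment that starts at the new level has length one. Its clause admits all learned
            -- ids, so a violation means that the step uses `τ`.
            original : t ≡ i → k ≡ 0
            original refl with k ≟ 0
            ... | yes k≡0 = k≡0
            ... | no  k≢0 = contradiction
              (blockingClause⁺ (suc t) ℓ π′ σ̄
                (inj₂ ( +-cancelˡ-≡ t ℓ 1 (trans t+ℓ≡1+i (+-comm 1 t))
                      , subst (_> 1) (sym κ-new) (s≤s (n≢0⇒n>0 k≢0)))))
              ¬sat

            segment-free : ¬ (⟪ E ⟫ ∘ μ (suc t) ℓ ⊩ cvp′ π′ σ̄)
            -- `entails` may change the extra variables, but the two states read off from `θ′` stay
            -- the same.
            segment-free h with θ′ , same , θ′⊩π′ ← CVP.entails π′ x∪x′ σ̄ σ̄⊨π′ _ h =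
              learned t≤i original (prefix (Run-≤ t≤i run′)) at′
                ( θ′
                , extends-⟨ (λ k → trans (same (pre k) refl) (sym (lookup∘tabulate _ k)))
                          , (λ k → trans (same (post k) refl)
                                     (trans (cong (λ j → E j (pre k)) s+ℓ≡) (E-end k))) ⟩
                , θ′⊩π′ )

          -- The clauses of the new level hold up to double negation. There are finitely many and
          -- the goal is a contradiction, so all of them may be assumed together.
          extend-run : ¬ (1 < suc i → κ (suc i) ≡ 1 ⊎ κ (suc i) ≢ κ i)
          extend-run dist = ¬¬-All (λ c∈ → ¬¬unblocked (blockedAt⁻ c∈)) λ sats →
            unreachable (suc i) record
              { E = E ; κ = κ ; end = E-end
              ; run = record { start = start run′ ; levels = levels′ sats } }
            where
            ¬¬-All : ∀ {P : Assertion → Set} {cs} → (∀ {c} → c ∈ cs → ¬ ¬ P c) → ¬ ¬ All P cs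
            ¬¬-All {cs = []}     _ ¬all = ¬all []
            ¬¬-All {cs = c ∷ cs} h ¬all =
              h (here refl) λ p → ¬¬-All (h ∘ there) λ ps → ¬all (p ∷ ps)

            levels′ : All (Sat ⟪ E ⟫ κ) (blockedAt (suc i) blocked) →
                      ∀ {j} → 1 ≤ j → j ≤ suc i → Level E κ j
            levels′ sats 1≤j j≤ with m≤n⇒m<n∨m≡n j≤
            ... | inj₁ (s≤s j≤i) = levels run′ 1≤j j≤i
            ... | inj₂ refl      = record
              { k = k ; π = π ; at = at ; id-is = κ-new ; step = step′ ; distinct = dist
              ; unblocked = All.lookup sats }

          -- Id one and level one meet the id constraint at once. Otherwise it fails only if the
          -- previous level used the same learned relation, and then transitivity merges the two
          -- steps.
          case-distinct : ∀ i₁ k₁ → i ≡ i₁ → k ≡ k₁ → ⊥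
          case-distinct _        zero     _    refl = extend-run λ _ → inj₁ κ-new
          case-distinct zero     (suc _)  refl _    = extend-run λ { (s≤s ()) }
          case-distinct (suc i₀) (suc k₀) refl refl with κ (suc i₀) ≟ suc (suc k₀)
          ... | no κ≢  = extend-run λ _ → inj₂ λ eq → κ≢ (trans (sym eq) κ-new)
          ... | yes κ≡ = learned (n≤1+n i₀) (λ eq → contradiction (sym eq) 1+n≢n)
                           (prefix (Run-≤ (n≤1+n i₀) run′)) at₀
                           (transitive (ρ⊑π⃗ _ at) last-step u→v)
            where
            last : Level E κ (suc i₀)
            last = levels run′ (s≤s z≤n) ≤-refl

            at-last : ρ (suc i₀) ‼ suc (suc k₀) ≡ just (Level.π last)
            at-last = trans (cong (ρ (suc i₀) ‼_) (trans (sym κ≡) (id-is last))) (Level.at last)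

            -- Both levels use the same position, and both lists embed into `π⃗`. Hence the merged
            -- step is available already in the list of the earlier level.
            π≡ : Level.π last ≡ π
            π≡ = just-injective (trans (sym (ρ⊑π⃗ _ at-last)) (ρ⊑π⃗ _ at))

            at₀ : ρ (suc i₀) ‼ suc (suc k₀) ≡ just π
            at₀ = trans at-last (cong just π≡)

            last-step : tupleAt E (suc i₀) -[ π ]→ u
            last-step = θ₀ , extends-⟨ (λ k → sym (lookup∘tabulate (λ k → θ₀ (pre k)) k)) , to-u ⟩
                           , subst (θ₀ ⊩_) π≡ (step last)
              where
              θ₀ : Var → Carrier
              θ₀ = ⟪ E ⟫ ∘ μ (suc i₀) 1

              to-u : ∀ k → E (suc i₀ + 1) (pre k) ≡ lookup u k
              to-u k = trans (cong (λ j → E j (pre k)) (cong suc (+-comm i₀ 1)))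
                             (trans (sym (Agree.end agree k)) (end k))

        NoLearnedStep : ℕ → Set
        NoLearnedStep i = ∀ {k π u} → Reach i u → ρ (suc i) ‼ suc (suc k) ≡ just π →
                          ¬ (u -[ π ]→ v)

        -- For a learned step the side condition of `step-to` rules out the same level, so induction
        -- on the level suffices.
        no-learned-step : ∀ i → NoLearnedStep i
        no-learned-step = <-rec NoLearnedStep λ i IH → step-to i λ i′≤i i′≡i⇒⊥ →
          IH (≤∧≢⇒< i′≤i λ i′≡i → contradiction (i′≡i⇒⊥ i′≡i) λ ())

        -- A violation may now fall back to a learned step on the same level; these are already
        -- excluded on every level.
        no-original-step : ∀ i {u} → Reach i u → ¬ (u -[ τ ]→ v)
        no-original-step i R = step-to i (λ {i′} _ _ → no-learned-step i′) R (ρ-head (suc i))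

      initially-reached : ∀ {v} → [x/ v ] ⊨ init → Reach 0 v
      initially-reached {v} v⊨init = record
        { E = λ _ → θ ; κ = λ _ → 0 ; end = λ _ → refl
        ; run = record { start = start₀ ; levels = λ 1≤j j≤0 → contradiction (≤-trans 1≤j j≤0) λ () }
        }
        where
        θ : Var → Carrier
        θ y = fromMaybe point ([x/ v ] y)

        start₀ : ⟪ (λ _ → θ) ⟫ ∘ μ 1 1 ⊩ init
        start₀ = subst id (⊩-cong structure init λ {y} y∈ → eq (init-vars y y∈))
                          (proj₂ v⊨init θ λ { (pre k) _ refl → refl })
          where
          eq : ∀ {y} → IsPre y → θ y ≡ ⟪ (λ _ → θ) ⟫ (μ 1 1 y)
          eq (pre k) = refl

      error-found : ∀ {i v} → Reach i v → [x/ v ] ⊨ err →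
                    CheckSat (errorCheck (suc i) (build ρ blocked i))
      error-found {i} {v} R v⊨err = All-Sat⇒CheckSat (errorCheck (suc i) (build ρ blocked i))
        (subst id (sym (Sat-⌜rename⌝ (μ (suc i) 1) err))
                  (proj₂ v⊨err (⟪ E ⟫ ∘ μ (suc i) 1) λ { (pre k) _ refl → end k })
         ∷ Run⇒All-Sat i run)
        where open Reach R

    -- The invariant

    -- `fresh` lets `build` anticipate the next unrolling. `error-free` records the failed error
    -- checks for the levels below `b`, restated for the current labelling.
    record Invariant (b : ℕ) (π⃗ : List Formula) (blocked : List (ℕ × Assertion)) (S : Solver) :
                     Set where
      field
        labelling : Labelling π⃗ blocked
      open Labelling labelling public
      field
        built : S ≡ build ρ blocked b
        fresh : ∀ {i} → b < i → ρ i ≡ π⃗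
        error-free : ∀ {i} → i < b → ¬ CheckSat (errorCheck (suc i) (build ρ blocked i))

    invariant-initial : Invariant 0 [ τ ] [] (State.smt initial)
    invariant-initial = record
      { labelling = record
          { ρ = λ _ → [ τ ] ; ρ-head = λ _ → refl ; ρ⊑π⃗ = λ _ → id
          ; transitive = λ () ; blocking = λ () }
      ; built = refl
      ; fresh = λ _ → refl
      ; error-free = λ ()
      }

    -- Safety from the failed final check.

    safe-sound : ∀ {b π⃗ blocked S} → Invariant b π⃗ blocked S →
                 ¬ CheckSat (errorCheck (suc b) S) →
                 ¬ CheckSat (unroll (suc b) π⃗ blocked S) → SafeProblem T
    safe-sound {b} {π⃗} {blocked} I no-err unsat (v , v′ , v⊨init , steps , v′⊨err) =
      follow steps (initially-reached v⊨init)
      where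
      open Invariant I
      open Runs labelling

      -- A longer run, cut down to `suc b` levels, would satisfy the final check; `fresh` identifies
      -- the list of level `suc b` with `π⃗`.
      bounded : ∀ {i u} → Reach i u → i ≤ b
      bounded {i} R with i ≤? b
      ... | yes i≤b = i≤b
      ... | no  i≰b = contradiction
        (subst₂ (λ ρ′ S → CheckSat (unroll (suc b) ρ′ blocked S)) (fresh ≤-refl) (sym built)
          (All-Sat⇒CheckSat (build ρ blocked (suc b))
            (Run⇒All-Sat (suc b) (Run-≤ (≰⇒> i≰b) (Reach.run R)))))
        unsat

      follow : ∀ {i u} → Star (λ u w → u -[ τ ]→ w) u v′ → Reach i u → ⊥
      follow ε R with m≤n⇒m<n∨m≡n (bounded R)
      ... | inj₁ i<b  = error-free i<b (error-found R v′⊨err)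
      ... | inj₂ refl = no-err
        (subst (λ S → CheckSat (errorCheck (suc b) S)) (sym built) (error-found R v′⊨err))
      -- The recursive call refutes that the next state is reached on any level. This is the
      -- assumption `unreachable` under which the step itself is impossible.
      follow {i} (u→w ◅ w→*v′) R =
        no-original-step (λ j R′ → follow w→*v′ R′) i R u→w

    -- Preservation of the invariant by the iterations of the algorithm.

    invariant-unroll : ∀ {b π⃗ blocked S} → Invariant b π⃗ blocked S →
                       ¬ CheckSat (errorCheck (suc b) S) →
                       Invariant (suc b) π⃗ blocked (unroll (suc b) π⃗ blocked S)
    invariant-unroll {b} {π⃗} {blocked} I no-err = record
      { labelling  = labelling
      ; built      = cong₂ (λ ρ′ S → unroll (suc b) ρ′ blocked S) (sym (fresh ≤-refl)) built
      ; fresh      = λ b<i → fresh (<⇒≤ b<i)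
      ; error-free = error-free′
      }
      where
      open Invariant I

      error-free′ : ∀ {i} → i < suc b → ¬ CheckSat (errorCheck (suc i) (build ρ blocked i))
      error-free′ (s≤s i≤b) with m≤n⇒m<n∨m≡n i≤b
      ... | inj₁ i<b  = error-free i<b
      ... | inj₂ refl = subst (λ S → ¬ CheckSat (errorCheck (suc b) S)) built no-err

    -- Level `i` was asserted with `ρ i`, whereas the trace looks ids up in `π⃗`; the prefix order
    -- reconciles the two.
    model-selects : ∀ {b π⃗ blocked S M i} → Invariant b π⃗ blocked S → M Satisfies S →
                    1 ≤ i → i ≤ b → Selected M i π⃗
    model-selects {b} {π⃗} {blocked} {M = M} {i} I M⊨S 1≤i i≤b =
      record { k = Selected.k sel ; π = Selected.π sel ; at = ρ⊑π⃗ i (Selected.at sel)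
             ; id-is = Selected.id-is sel ; model = Selected.model sel }
      where
      open Invariant I

      disjunction∈build : ∀ {j} → 1 ≤ j → ∀ {b} → j ≤ b →
                          disjunction j 1 (ρ j) ∈ assertions (build ρ blocked b)
      disjunction∈build (s≤s _) {suc b} j≤
        rewrite assertions-unroll (suc b) (ρ (suc b)) blocked (build ρ blocked b)
        with m≤n⇒m<n∨m≡n j≤
      ... | inj₂ refl      = ∈-++⁺ˡ (∈-++⁺ʳ (blockedAt (suc b) blocked) (here refl))
      ... | inj₁ (s≤s j≤b) =
        ∈-++⁺ʳ (levelAssertions (suc b) (ρ (suc b)) blocked) (disjunction∈build (s≤s z≤n) j≤b)

      sel : Selected M i (ρ i)
      sel = disjunction-selects (All.lookup (subst (M Satisfies_) built M⊨S) (disjunction∈build 1≤i i≤b))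

    backtrack-built : ∀ {b S t ρ blocked} → S ≡ build ρ blocked b → t ≤ b →
                      backtrack (suc t) b S ≡ (t , build ρ blocked t)
    backtrack-built {b} {t = t} {ρ} {blocked} refl t≤b =
      subst (λ n → backtrack (suc t) n (build ρ blocked n) ≡ (t , build ρ blocked t))
            (m∸n+n≡m t≤b) (backtrack-build ρ blocked t (b ∸ t))

    -- Here `s` is `suc t`. That level is popped and labelled with `π⃗′`, so its list contains the
    -- relation of the new clause, as `Blocking` demands. Old clauses survive because lists only
    -- grow.
    invariant-backtrack : ∀ {b π⃗ π⃗′ blocked S t ℓ π σ̄} → Invariant b π⃗ blocked S →
      t ≤ b → 1 ≤ ℓ → π⃗ ⊑ π⃗′ →
      (∀ {k φ} → π⃗′ ‼ suc (suc k) ≡ just φ → Transitive (λ u w → u -[ φ ]→ w)) →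
      π ∈ tail π⃗′ → σ̄ ⊨ π →
      let bS = backtrack (suc t) b S in
      Invariant (proj₁ bS) π⃗′ ((t + ℓ , blockingClause (suc t) ℓ π σ̄) ∷ blocked) (proj₂ bS)
    invariant-backtrack {b} {π⃗} {π⃗′} {blocked} {S} {t} {ℓ} {π} {σ̄} I t≤b 1≤ℓ π⃗⊑π⃗′ trans′ π∈ σ̄⊨π =
      subst (λ bS → Invariant (proj₁ bS) π⃗′ blocked′ (proj₂ bS)) (sym (backtrack-built built t≤b))
        record
          { labelling = record
              { ρ          = ρ′
              ; ρ-head     = λ i → ρ⊑ρ′ i (ρ-head i)
              ; ρ⊑π⃗        = ρ′⊑π⃗′
              ; transitive = trans′
              ; blocking   = blocking′
              }
          ; built      = build-eq ≤-refl
          ; fresh      = replaced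
          ; error-free = λ i<t → subst (λ S′ → ¬ CheckSat (errorCheck _ S′)) (build-eq (<⇒≤ i<t))
                                       (error-free (<-≤-trans i<t t≤b))
          }
      where
      open Invariant I

      blocked′ : List (ℕ × Assertion)
      blocked′ = (t + ℓ , blockingClause (suc t) ℓ π σ̄) ∷ blocked

      -- Only the levels above t are asserted anew with the extended list.
      ρ′ : ℕ → List Formula
      ρ′ = splice (suc t) ρ π⃗′ π⃗′

      kept : ∀ {i} → i ≤ t → ρ i ≡ ρ′ i
      kept i≤t = sym (splice-< (s≤s i≤t))

      replaced : ∀ {i} → t < i → ρ′ i ≡ π⃗′
      replaced t<i with m≤n⇒m<n∨m≡n t<i
      ... | inj₁ 1+t<i = splice-> {f = ρ} 1+t<i
      ... | inj₂ refl  = splice-≡ {m = suc t} {ρ}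

      ρ⊑ρ′ : ∀ i → ρ i ⊑ ρ′ i
      ρ⊑ρ′ i {k} at with i ≤? t
      ... | yes i≤t = trans (cong (_‼ suc k) (sym (kept i≤t))) at
      ... | no  i≰t = trans (cong (_‼ suc k) (replaced (≰⇒> i≰t))) (π⃗⊑π⃗′ (ρ⊑π⃗ i at))

      ρ′⊑π⃗′ : ∀ i → ρ′ i ⊑ π⃗′
      ρ′⊑π⃗′ i {k} at with i ≤? t
      ... | yes i≤t = π⃗⊑π⃗′ (ρ⊑π⃗ i (trans (cong (_‼ suc k) (kept i≤t)) at))
      ... | no  i≰t = trans (cong (_‼ suc k) (sym (replaced (≰⇒> i≰t)))) at

      blocking′ : ∀ {j c} → (j , c) ∈ blocked′ → Blocking ρ′ j c
      blocking′ (here refl) with k , at ← ∈-tail⇒‼ π⃗′ π∈ = record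
        { s = suc t ; ℓ = ℓ ; k = k ; π = π ; σ̄ = σ̄ ; 1≤s = s≤s z≤n ; 1≤ℓ = 1≤ℓ
        ; s+ℓ≡1+j = refl ; at = trans (cong (_‼ suc (suc k)) (replaced ≤-refl)) at
        ; model = σ̄⊨π ; form = refl }
      blocking′ (there p∈) = record
        { s = B.s ; ℓ = B.ℓ ; k = B.k ; π = B.π ; σ̄ = B.σ̄ ; 1≤s = B.1≤s ; 1≤ℓ = B.1≤ℓ
        ; s+ℓ≡1+j = B.s+ℓ≡1+j ; at = ρ⊑ρ′ B.s B.at ; model = B.model ; form = B.form }
        where module B = Blocking (blocking p∈)

      -- As `1 ≤ ℓ`, the new clause belongs to the level `t + ℓ` above all kept levels.
      build-eq : ∀ {i} → i ≤ t → build ρ blocked i ≡ build ρ′ blocked′ i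
      build-eq {i} i≤t = build-cong {blocked = blocked} {blocked′} i
        (λ j≤i → kept (≤-trans j≤i i≤t))
        (λ {j} j≤i → cong (map proj₂) (sym (filter-reject (λ p → proj₁ p ≟ j) {xs = blocked}
          λ t+ℓ≡j → <⇒≱ (≤-trans (≤-reflexive (+-comm 1 t)) (+-monoʳ-≤ t 1≤ℓ))
                        (≤-trans (≤-reflexive t+ℓ≡j) (≤-trans j≤i i≤t)))))

    Learn-⊑ : ∀ {M τs s ℓ π⃗ π⃗′} → Learn M τs s ℓ π⃗ π⃗′ → π⃗ ⊑ π⃗′
    Learn-⊑ (reuse _) e = e
    Learn-⊑ {π⃗ = π⃗} (new _) {k} e = ‼-∷ʳ⁺ {xs = π⃗} k e

    Learn-transitive : ∀ {M τs s ℓ π⃗ π⃗′} → Learn M τs s ℓ π⃗ π⃗′ →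
      1 ≤ s → 1 ≤ ℓ → Transitions (Model.val M) 1 τs →
      (∀ {k π} → π⃗ ‼ suc (suc k) ≡ just π → Transitive (λ u w → u -[ π ]→ w)) →
      ∀ {k π} → π⃗′ ‼ suc (suc k) ≡ just π → Transitive (λ u w → u -[ π ]→ w)
    Learn-transitive (reuse _) _ _ _ old at = old at
    Learn-transitive {M} {s = s} {ℓ} {π⃗} (new _) 1≤s 1≤ℓ ts old {k} at with ‼-∷ʳ⁻ π⃗ (suc k) at
    ... | inj₁ at′  = old at′
    ... | inj₂ refl = learned-transitive {M} s ℓ 1≤s 1≤ℓ ts

    returns-safe : ∀ {b π⃗ blocked S} → Invariant b π⃗ blocked S →
                   Star _⟿_ (running (state b π⃗ blocked S)) (returned safe) → SafeProblem T
    returns-safe I (return-unknown _ ◅ () ◅ _)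
    -- `pop (errorCheck (suc b) S)` computes to `S`, so the error check leaves no trace in the
    -- types.
    returns-safe I (return-safe no-err unsat ◅ ε) = safe-sound I no-err unsat
    returns-safe I (no-loop M no-err _ _ ◅ rest) =
      returns-safe (invariant-unroll I no-err) rest
    returns-safe I (block-loop M zero ℓ π⃗′ π σ̄ no-err M⊨ L learn π∈ _ σ̄⊨π ◅ rest) =
      contradiction (LoopAt.1≤s L) λ ()
    returns-safe {b} {π⃗} I (block-loop M (suc t) ℓ π⃗′ π σ̄ no-err M⊨ L learn π∈ _ σ̄⊨π ◅ rest) =
      returns-safe (invariant-backtrack I′ t≤1+b 1≤ℓ (Learn-⊑ learn)
                     (Learn-transitive learn 1≤s 1≤ℓ ts (Invariant.transitive I′)) π∈ σ̄⊨π) rest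
      where
      open LoopAt L
      I′ = invariant-unroll I no-err

      t≤1+b : t ≤ suc b
      t≤1+b = ≤-trans (m≤m+n t ℓ) inside

      ts : Transitions (Model.val M) 1 (trace (suc b) M π⃗)
      ts = trace-transitions {π⃗ = π⃗} suc (suc b) 1 (λ m → +-comm 1 m)
             λ 1≤j j< → model-selects I′ M⊨ 1≤j
               (≤-pred (≤-trans j< (≤-reflexive (+-comm (suc b) 1))))

theorem1 : {Sg : Signature} (𝒜 : Theory Sg) (d : ℕ) →
    let open Setting 𝒜 d in
    (T : SafetyProblem)
    (cvp : Formula → Valuation → VarSet → Formula) →
    IsConjunctiveVariableProjection cvp →
    (tp : Formula → Valuation → Formula) →
    IsTransitiveProjection tp →
    TRL.Returns T cvp tp safe →
    SafeProblem T
theorem1 𝒜 d T cvp cvp-proj tp tp-proj =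
  returns-safe 𝒜 d T cvp cvp-proj tp tp-proj
    (invariant-initial 𝒜 d T cvp cvp-proj tp tp-proj)
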